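{- For a skew partition $\nu/\lambda$, $$g_{\nu/\lambda}(x)=\sum_{T} s_{\mathrm{weight}(T)}(x),$$ where the sum is over all Yamanouchi tabloids $T$ of inflated shape $\nu/\lambda$.
   Context: Rows of shapes are counted upward from the bottom, columns from left to right; $\nu/\lambda$ ($\lambda\subseteq\nu$ partitions) is the set of cells of $\nu$ not in $\lambda$. $s_\mu$ is the Schur function. A reverse plane partition of shape $\nu/\lambda$ is a filling of $\nu/\lambda$ with positive integers that is weakly increasing along rows from left to right and weakly increasing up columns. The weight of a reverse plane partition $r$ is the vector $\alpha$ with $\alpha_i$ the number of columns of $r$ containing $i$. $g_{\nu/\lambda}(x)=\sum_r x^{\mathrm{weight}(r)}$ over all reverse plane partitions $r$ of shape $\nu/\lambda$. A tabloid is a filling of the shape of a composition (zero parts allowed) with positive integers, weakly increasing from left to right along rows; its weight is the composition whose $i$-th entry is the number of $i$'s, and its reading word lists the rows from top to bottom, each from left to right. A tabloid is Yamanouchi if each suffix $b_j\cdots b_1$ of its reading word $b_n\cdots b_1$ has partition weight (i.e. contains at least as many $i$'s as $(i+1)$'s for every $i\ge1$). To a reverse plane partition $r$ of shape $\nu/\lambda$ associate the tabloid obtained by deleting every letter that is not the topmost occurrence of that letter in its column, and then left-justifying the letters of each row (keeping $\ell(\nu)$ rows, some possibly empty). A tabloid has inflated shape $\nu/\lambda$ if it is the tabloid associated in this way to a reverse plane partition of shape $\nu/\lambda$ (which is then unique). -}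

module Defs where

open import Data.List.Base using (List; []; _∷_; [_]; map; foldr; filter;
  length; concat; reverse; tails; applyUpTo; deduplicate; cartesianProductWith)
open import Data.List.Properties using (≡-dec; length-applyUpTo; length-filter;
  length-map; ∷-injective; length-++)
open import Data.List.Membership.Propositional using (_∈_)
open import Data.List.Membership.Propositional.Properties using (∈-map⁺; ∈-map⁻;
  ∈-filter⁺; ∈-filter⁻; ∈-++⁺ˡ; ∈-++⁺ʳ; ∈-++⁻; ∈-concat⁺′; ∈-concat⁻′;
  ∈-applyUpTo⁺; ∈-cartesianProductWith⁺; ∈-cartesianProductWith⁻;
  ∈-deduplicate⁺; ∈-deduplicate⁻)
open import Data.List.Relation.Binary.Permutation.Propositional.Properties
  using (map⁺; ↭-reverse)
open import Data.List.Relation.Unary.All using (All; []; _∷_; all?)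
import Data.List.Relation.Unary.All as All
import Data.List.Relation.Unary.All.Properties as All
open import Data.List.Relation.Unary.AllPairs using (AllPairs; []; _∷_; allPairs?)
open import Data.List.Relation.Unary.Any using (here; there)
open import Data.List.Relation.Unary.Any.Properties using (reverse⁺)
open import Data.List.Relation.Unary.Linked using (Linked; linked?)
open import Data.List.Relation.Unary.Unique.Propositional using (Unique)
import Data.List.Relation.Unary.Unique.Propositional.Properties as Unique
import Data.List.Relation.Unary.Unique.DecPropositional.Properties as DecUnique
open import Data.Nat.Base using (ℕ; zero; suc; _+_; _∸_; _⊔_; _≤_; _<_; _≥_; z≤n; s≤s)
open import Data.Nat.ListAction using (sum)
open import Data.Nat.ListAction.Properties using (sum-↭)
open import Data.Nat.Properties using (_≟_; _≤?_; _<?_; _≥?_; ≤-trans; ≤-reflexive;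
  +-mono-≤; m≤m⊔n; m≤n⊔m; n≤1+n; <-irrefl)
open import Data.Product using (_×_; _,_; proj₁; proj₂; ∃)
open import Data.Product.Properties using () renaming (≡-dec to ×-≡-dec)
open import Data.Sum.Base using (inj₁; inj₂)
open import Function.Base using (_∘_; _on_)
open import Function.Bundles using (_⇔_; mk⇔; Equivalence)
open import Relation.Binary.Core using (Rel)
open import Relation.Binary.Definitions using (DecidableEquality) renaming (Decidable to Decidable₂)
open import Relation.Binary.PropositionalEquality using (_≡_; refl; sym; trans; cong; subst)
open import Relation.Nullary.Decidable using (yes; no; ¬?; _×-dec_; _→-dec_)
open import Relation.Nullary.Negation using (contradiction)
open import Relation.Unary using (Decidable)
open import Level using (0ℓ)

-- A finite subset of A.
record Enumeration {A : Set} (P : A → Set) : Set where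
  field
    elements : List A
    unique   : Unique elements
    complete : ∀ x → x ∈ elements ⇔ P x

open Enumeration public

∣_∣ : ∀ {A : Set} {P : A → Set} → Enumeration P → ℕ
∣ E ∣ = length (elements E)

-- A formal power series in x₁, x₂, …, given by its coefficients, where the
-- list α₁ ∷ … ∷ αₙ ∷ [] stands for the monomial x₁^α₁ ⋯ xₙ^αₙ.  Every
-- monomial has exactly one representation without trailing zeros; the weights
-- below are always of this form, so the coefficients at other lists are 0.
PowerSeries : Set
PowerSeries = List ℕ → ℕ

infix 4 _≈_

_≈_ : PowerSeries → PowerSeries → Set
f ≈ h = ∀ α → f α ≡ h α

∑ : List PowerSeries → PowerSeries
∑ fs α = sum (map (λ f → f α) fs)

IsPartition : List ℕ → Set
IsPartition μ = Linked _≥_ μ × All (0 <_) μ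

part : List ℕ → ℕ → ℕ
part []      _       = 0
part (m ∷ μ) zero    = m
part (m ∷ μ) (suc i) = part μ i

infix 4 _⊆_

_⊆_ : List ℕ → List ℕ → Set
λ′ ⊆ ν = ∀ i → part λ′ i ≤ part ν i

-- For every row of ν/λ, from the bottom row upward, the columns of its cells
-- from left to right.
skew : List ℕ → List ℕ → List (List ℕ)
skew ν λ′ =
  applyUpTo (λ i → applyUpTo (part λ′ i +_) (part ν i ∸ part λ′ i)) (length ν)

count : ℕ → List ℕ → ℕ
count i w = length (filter (i ≟_) w)

largest : List ℕ → ℕ
largest = foldr _⊔_ 0

-- The i-th entry counts the letter i, for i = 1, …, largest w.
weight : List ℕ → List ℕ
weight w = applyUpTo (λ i → count (suc i) w) (largest w)

-- A filled cell is a pair (column , letter).  A filling lists its rows from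
-- the bottom row upward, and each row from left to right.
Cell : Set
Cell = ℕ × ℕ

column letter : Cell → ℕ
column = proj₁
letter = proj₂

Filling : Set
Filling = List (List Cell)

letters : Filling → List ℕ
letters r = map letter (concat r)

IsFilling : List (List ℕ) → Filling → Set
IsFilling shape r = map (map column) r ≡ shape × All (All ((0 <_) ∘ letter)) r

RowsWeaklyIncreasing : Filling → Set
RowsWeaklyIncreasing = All (Linked (_≤_ on letter))

-- Whenever two cells lie in the same column, their letters, the lower one
-- first, are related by R.
UpColumns : Rel ℕ 0ℓ → Filling → Set
UpColumns R = AllPairs λ lower upper →
  All (λ c → All (λ d → column c ≡ column d → R (letter c) (letter d)) upper) lower

IsRPP : List ℕ → List ℕ → Filling → Set
IsRPP ν λ′ r = IsFilling (skew ν λ′) r × RowsWeaklyIncreasing r × UpColumns _≤_ r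

columnsContaining : ℕ → Filling → List ℕ
columnsContaining i r =
  deduplicate _≟_ (map column (filter ((i ≟_) ∘ letter) (concat r)))

rppWeight : Filling → List ℕ
rppWeight r = applyUpTo (λ i → length (columnsContaining (suc i) r)) (largest (letters r))

IsSSYT : List ℕ → Filling → Set
IsSSYT μ t = IsFilling (skew μ []) t × RowsWeaklyIncreasing t × UpColumns _<_ t

-- Rows from the bottom row upward.
Tabloid : Set
Tabloid = List (List ℕ)

IsTabloid : Tabloid → Set
IsTabloid T = All (All (0 <_)) T × All (Linked _≤_) T

readingWord : Tabloid → List ℕ
readingWord T = concat (reverse T)

IsYamanouchi : Tabloid → Set
IsYamanouchi T = All (IsPartition ∘ weight) (tails (readingWord T))

_≟ᶜ_ : DecidableEquality Cell
_≟ᶜ_ = ×-≡-dec _≟_ _≟_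

open import Data.List.Membership.DecPropositional _≟ᶜ_ using (_∈?_)

-- A letter of the row is kept unless its column contains it again higher up.
tabloid : Filling → Tabloid
tabloid []            = []
tabloid (row ∷ above) =
  map letter (filter (λ c → ¬? (c ∈? concat above)) row) ∷ tabloid above

HasInflatedShape : List ℕ → List ℕ → Tabloid → Set
HasInflatedShape ν λ′ T = ∃ λ r → IsRPP ν λ′ r × tabloid r ≡ T

isFilling? : ∀ shape → Decidable (IsFilling shape)
isFilling? shape r =
  ≡-dec (≡-dec _≟_) (map (map column) r) shape ×-dec all? (all? ((0 <?_) ∘ letter)) r

rows? : Decidable RowsWeaklyIncreasing
rows? = all? (linked? λ c d → letter c ≤? letter d)

upColumns? : ∀ {R : Rel ℕ 0ℓ} → Decidable₂ R → Decidable (UpColumns R)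
upColumns? R? = allPairs? λ lower upper →
  all? (λ c → all? (λ d → (column c ≟ column d) →-dec R? (letter c) (letter d)) upper) lower

isRPP? : ∀ ν λ′ → Decidable (IsRPP ν λ′)
isRPP? ν λ′ r = isFilling? (skew ν λ′) r ×-dec rows? r ×-dec upColumns? _≤?_ r

isSSYT? : ∀ μ → Decidable (IsSSYT μ)
isSSYT? μ t = isFilling? (skew μ []) t ×-dec rows? t ×-dec upColumns? _<?_ t

isPartition? : Decidable IsPartition
isPartition? μ = linked? _≥?_ μ ×-dec all? (0 <?_) μ

isTabloid? : Decidable IsTabloid
isTabloid? T = all? (all? (0 <?_)) T ×-dec all? (linked? _≤?_) T

isYamanouchi? : Decidable IsYamanouchi
isYamanouchi? T = all? (isPartition? ∘ weight) (tails (readingWord T))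

choices : ∀ {A : Set} → List (List A) → List (List A)
choices = foldr (cartesianProductWith _∷_) [ [] ]

choices-unique : ∀ {A : Set} {xss : List (List A)} → All Unique xss → Unique (choices xss)
choices-unique []       = [] ∷ []
choices-unique (u ∷ us) = Unique.cartesianProductWith⁺ _∷_ ∷-injective u (choices-unique us)

rowFillings : ℕ → List ℕ → List (List Cell)
rowFillings n cols = choices (map (λ c → map (c ,_) (applyUpTo suc n)) cols)

fillings : ℕ → List (List ℕ) → List Filling
fillings n shape = choices (map (rowFillings n) shape)

rowFillings-unique : ∀ n cols → Unique (rowFillings n cols)
rowFillings-unique n cols = choices-unique (All.map⁺ (All.universal unique-column cols))
  where
  unique-column : ∀ c → Unique (map (c ,_) (applyUpTo suc n))
  unique-column c = Unique.map⁺ (cong proj₂)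
    (Unique.applyUpTo⁺₁ suc n λ { i<j _ refl → <-irrefl refl i<j })

fillings-unique : ∀ n shape → Unique (fillings n shape)
fillings-unique n shape =
  choices-unique (All.map⁺ (All.universal (rowFillings-unique n) shape))

∈-rowFillings⁺ : ∀ {n} row → All ((0 <_) ∘ letter) row → All ((_≤ n) ∘ letter) row →
                 row ∈ rowFillings n (map column row)
∈-rowFillings⁺ []                  []           []           = here refl
∈-rowFillings⁺ ((c , suc v) ∷ row) (_ ∷ pos) (v≤n ∷ bnd) =
  ∈-cartesianProductWith⁺ _∷_ (∈-map⁺ (c ,_) (∈-applyUpTo⁺ suc v≤n)) (∈-rowFillings⁺ row pos bnd)

∈-fillings⁺ : ∀ {n} r → All (All ((0 <_) ∘ letter)) r → All (All ((_≤ n) ∘ letter)) r →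
              r ∈ fillings n (map (map column) r)
∈-fillings⁺ []        []           []           = here refl
∈-fillings⁺ (row ∷ r) (pos ∷ poss) (bnd ∷ bnds) =
  ∈-cartesianProductWith⁺ _∷_ (∈-rowFillings⁺ row pos bnd) (∈-fillings⁺ r poss bnds)

enumerateFillings : ∀ {P : Filling → Set} shape n → Decidable P →
                    (∀ {r} → P r → IsFilling shape r) →
                    (∀ {r} → P r → All (_≤ n) (letters r)) →
                    Enumeration P
enumerateFillings {P} shape n P? P⇒filling P⇒bounded = record
  { elements = filter P? (fillings n shape)
  ; unique   = Unique.filter⁺ P? (fillings-unique n shape)
  ; complete = λ r → mk⇔ (λ r∈ → proj₂ (∈-filter⁻ P? {xs = fillings n shape} r∈)) (member r)
  }
  where
  member : ∀ r → P r → r ∈ filter P? (fillings n shape)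
  member r p with refl , pos ← P⇒filling p =
    ∈-filter⁺ P? (∈-fillings⁺ r pos (All.concat⁻ (All.map⁻ (P⇒bounded p)))) p

≤-largest : ∀ w → All (_≤ largest w) w
≤-largest []      = []
≤-largest (x ∷ w) =
  m≤m⊔n x (largest w) ∷ All.map (λ y≤ → ≤-trans y≤ (m≤n⊔m x (largest w))) (≤-largest w)

bounded-by-exponent : ∀ (f : ℕ → ℕ) {w α} → applyUpTo f (largest w) ≡ α → All (_≤ length α) w
bounded-by-exponent f {w} refl =
  subst (λ n → All (_≤ n) w) (sym (length-applyUpTo f (largest w))) (≤-largest w)

-- A filling of weight α has all letters at most length α, so the search below
-- is exhaustive.
rpps : ∀ ν λ′ α → Enumeration (λ r → IsRPP ν λ′ r × rppWeight r ≡ α)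
rpps ν λ′ α = enumerateFillings (skew ν λ′) (length α)
  (λ r → isRPP? ν λ′ r ×-dec ≡-dec _≟_ (rppWeight r) α)
  (proj₁ ∘ proj₁)
  (λ {r} p → bounded-by-exponent (λ i → length (columnsContaining (suc i) r)) (proj₂ p))

ssyts : ∀ μ α → Enumeration (λ t → IsSSYT μ t × weight (letters t) ≡ α)
ssyts μ α = enumerateFillings (skew μ []) (length α)
  (λ t → isSSYT? μ t ×-dec ≡-dec _≟_ (weight (letters t)) α)
  (proj₁ ∘ proj₁)
  (λ {t} p → bounded-by-exponent (λ i → count (suc i) (letters t)) (proj₂ p))

yamanouchi-bounded : ∀ w → All (IsPartition ∘ weight) (tails w) →
                     ∀ {v} → v ∈ w → v ≤ length w
yamanouchi-bounded (b ∷ w) (_ ∷ yam) (there v∈w) =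
  ≤-trans (yamanouchi-bounded w yam v∈w) (n≤1+n _)
yamanouchi-bounded (zero        ∷ w) _ (here refl) = z≤n
yamanouchi-bounded (suc zero    ∷ w) _ (here refl) = s≤s z≤n
yamanouchi-bounded (suc (suc b) ∷ w) (p ∷ yam) (here refl) =
  s≤s (yamanouchi-bounded w yam (positive⇒∈ positive))
  where
  word = suc (suc b) ∷ w

  positive : 0 < count (suc b) word
  positive = All.applyUpTo⁻ (λ i → count (suc i) word) (largest word) (proj₂ p)
    (≤-trans (n≤1+n _) (All.head (≤-largest word)))
  
  positive⇒∈ : 0 < count (suc b) word → suc b ∈ w
  positive⇒∈ 0<c with filter (suc b ≟_) word in eq
  ... | x ∷ xs with ∈-filter⁻ (suc b ≟_) {xs = word} (subst (x ∈_) (sym eq) (here refl))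
  ...   | here refl  , ()
  ...   | there x∈w , refl = x∈w

-- The topmost occurrence of a letter in its column is never deleted, so a bound
-- on the letters of the tabloid also bounds those of the filling.
letter-survives : ∀ r {c} → c ∈ concat r → letter c ∈ concat (tabloid r)
letter-survives (row ∷ above) {c} c∈ with c ∈? concat above
... | yes c∈above = ∈-++⁺ʳ _ (letter-survives above c∈above)
... | no  c∉above with ∈-++⁻ row c∈
...   | inj₁ c∈row   = ∈-++⁺ˡ (∈-map⁺ letter (∈-filter⁺ (λ d → ¬? (d ∈? concat above)) c∈row c∉above))
...   | inj₂ c∈above = contradiction c∈above c∉above

size : ∀ {A : Set} → List (List A) → ℕ
size xss = sum (map length xss)

length-concat′ : ∀ {A : Set} (xss : List (List A)) → length (concat xss) ≡ size xss
length-concat′ []         = refl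
length-concat′ (xs ∷ xss) = trans (length-++ xs) (cong (length xs +_) (length-concat′ xss))

length-readingWord : ∀ T → length (readingWord T) ≡ size T
length-readingWord T =
  trans (length-concat′ (reverse T)) (sum-↭ (map⁺ length (↭-reverse T)))

size-tabloid : ∀ r → size (tabloid r) ≤ size (map (map column) r)
size-tabloid []            = z≤n
size-tabloid (row ∷ above) = +-mono-≤
  (≤-trans (≤-reflexive (length-map letter (filter _ row)))
    (≤-trans (length-filter _ row) (≤-reflexive (sym (length-map column row)))))
  (size-tabloid above)

concat⊆readingWord : ∀ T {v} → v ∈ concat T → v ∈ readingWord T
concat⊆readingWord T v∈ with row , v∈row , row∈T ← ∈-concat⁻′ T v∈ =
  ∈-concat⁺′ v∈row (reverse⁺ row∈T)

yamanouchiRPPs : ∀ ν λ′ → Enumeration (λ r → IsRPP ν λ′ r × IsYamanouchi (tabloid r))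
yamanouchiRPPs ν λ′ = enumerateFillings (skew ν λ′) (size (skew ν λ′))
  (λ r → isRPP? ν λ′ r ×-dec isYamanouchi? (tabloid r))
  (proj₁ ∘ proj₁)
  (λ {r} p → bounded r p)
  where
  bounded : ∀ r → IsRPP ν λ′ r × IsYamanouchi (tabloid r) → All (_≤ size (skew ν λ′)) (letters r)
  bounded r (((shape , _) , _) , yam) = All.map⁺ (All.tabulate λ c∈ →
    ≤-trans (yamanouchi-bounded _ yam (concat⊆readingWord (tabloid r) (letter-survives r c∈)))
    (≤-trans (≤-reflexive (length-readingWord (tabloid r)))
    (≤-trans (size-tabloid r) (≤-reflexive (cong size shape)))))

yamanouchiTabloids : ∀ ν λ′ →
  Enumeration (λ T → IsTabloid T × IsYamanouchi T × HasInflatedShape ν λ′ T)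
yamanouchiTabloids ν λ′ = record
  { elements = deduplicate _≟ᵗ_ candidates
  ; unique   = DecUnique.deduplicate-! _≟ᵗ_ candidates
  ; complete = λ T → mk⇔ sound member
  }
  where
  _≟ᵗ_ : DecidableEquality Tabloid
  _≟ᵗ_ = ≡-dec (≡-dec _≟_)

  rs = elements (yamanouchiRPPs ν λ′)

  candidates : List Tabloid
  candidates = filter isTabloid? (map tabloid rs)

  sound : ∀ {T} → T ∈ deduplicate _≟ᵗ_ candidates →
          IsTabloid T × IsYamanouchi T × HasInflatedShape ν λ′ T
  sound T∈ with T∈map , isT ← ∈-filter⁻ isTabloid? {xs = map tabloid rs} (∈-deduplicate⁻ _≟ᵗ_ candidates T∈)
    with r , r∈ , refl ← ∈-map⁻ tabloid T∈map
    with rpp , yam ← Equivalence.to (complete (yamanouchiRPPs ν λ′) r) r∈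
    = isT , yam , r , rpp , refl

  member : ∀ {T} → IsTabloid T × IsYamanouchi T × HasInflatedShape ν λ′ T →
           T ∈ deduplicate _≟ᵗ_ candidates
  member (isT , yam , r , rpp , refl) = ∈-deduplicate⁺ _≟ᵗ_ (∈-filter⁺ isTabloid?
    (∈-map⁺ tabloid (Equivalence.from (complete (yamanouchiRPPs ν λ′) r) (rpp , yam))) isT)

g : List ℕ → List ℕ → PowerSeries
g ν λ′ α = ∣ rpps ν λ′ α ∣

-- The Schur function of μ as the weight generating function of semistandard
-- tableaux; trailing zeros in μ only add empty rows.
s : List ℕ → PowerSeries
s μ α = ∣ ssyts μ α ∣

module Submission where

-- Let A i j be the number of letters i in row j of the tabloid of a reverse plane
-- partition r of shape ν/λ, and let ρ i be the shape filled by λ and the letters ≤ i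
-- of r.  Then ρ i j = A i j + max (ρ (i - 1) j) (ρ i (j + 1)), a last passage
-- recursion, so r is determined by A, and A comes from shape ν/λ exactly when the
-- recursion started at λ ends at ν.
--
-- Turning every unpaired i + 1 into an i, as the crystal operator eᵢ does when
-- applied as often as possible, changes two consecutive rows of A but not the last
-- passage values.  Iterating this on A₁, …, Aₙ is the RSK correspondence: it turns A
-- into a Yamanouchi matrix with the same λ and ν, and the weights of the matrices
-- obtained from the initial segments A₁, …, Aₘ form a Gelfand–Tsetlin pattern with
-- the content of A, that is, a semistandard tableau whose shape is the weight of the
-- Yamanouchi matrix.  Undoing the steps shows that this is a bijection.

open import Data.List.Base using (List; []; _∷_; map; filter; length; concat; applyUpTo; drop;
  [_]; _++_; reverse; tails)
open import Data.List.Membership.Propositional using (_∈_)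
open import Data.List.Membership.Propositional.Properties using (∈-map⁺; ∈-map⁻; ∈-applyUpTo⁺;
  ∈-applyUpTo⁻; ∈-++⁺ˡ; ∈-++⁺ʳ; ∈-++⁻; ∈-filter⁺; ∈-filter⁻; ∈-deduplicate⁺; ∈-deduplicate⁻;
  ∈-length)
open import Data.List.Membership.Propositional.Properties.WithK using (unique∧set⇒bag)
open import Data.List.Properties using (filter-none; filter-all; filter-accept; filter-reject;
  length-filter; length-applyUpTo; length-map; map-applyUpTo; filter-++; length-++;
  unfold-reverse; concat-++; ++-assoc; ++-identityʳ; map-++; map-∘) renaming (∷-injective to
  ∷ˡ-injective)
open import Data.List.Relation.Binary.BagAndSetEquality using (∼bag⇒↭)
open import Data.List.Relation.Binary.Permutation.Propositional.Properties using (↭-length)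
open import Data.List.Relation.Unary.All as All using (All; []; _∷_)
import Data.List.Relation.Unary.All.Properties as All
open import Data.List.Relation.Unary.AllPairs using (AllPairs; []; _∷_)
open import Data.List.Relation.Unary.Any using (here; there)
open import Data.List.Relation.Unary.Any.Properties using (reverse⁻)
open import Data.List.Relation.Unary.Linked as Linked using (Linked; []; [-]; _∷_)
import Data.List.Relation.Unary.Linked.Properties as Linked
import Data.List.Relation.Unary.Unique.DecPropositional.Properties as DecUnique
open import Data.List.Relation.Unary.Unique.Propositional using (Unique)
import Data.List.Relation.Unary.Unique.Propositional.Properties as Unique
open import Data.Nat.Base
import Data.Nat.ListAction as List
open import Data.Nat.Properties
open import Data.Nat.Tactic.RingSolver using (solve-∀)
open import Data.Product using (_×_; _,_; proj₁; proj₂; ∃; ∃₂; Σ)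
open import Data.Sum.Base using (_⊎_; inj₁; inj₂)
open import Data.Unit.Base using (⊤; tt)
open import Data.Vec.Base as Vec using (Vec; []; _∷_)
open import Data.Vec.Properties using (∷-injective)
open import Function.Base using (_∘_; _on_; id)
open import Function.Bundles using (_⇔_; mk⇔; Equivalence)
open import Level using (0ℓ)
open import Relation.Binary.Core using (Rel)
open import Relation.Binary.PropositionalEquality hiding ([_])
open import Relation.Nullary.Decidable using (yes; no; ¬?; _×-dec_; Dec)
open import Relation.Nullary.Negation using (contradiction; ¬_)
open import Relation.Unary using (Decidable)
open import Defs
open import Data.List.Membership.DecPropositional _≟ᶜ_ using (_∈?_)

open Equivalence using (to; from)

-- Pairing runs through the rows from the bottom upward and carries the number of unpaired letters
-- along, while the last passage recursion runs from the top row down. An induction on rows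
-- therefore needs the middle shape in closed form for an arbitrary state, and `between` is this
-- closed form. Raising as far as possible forgets how many letters were turned. That number is all
-- that has to be remembered to undo the step, and the pattern remembers it: it is the weight of the
-- raised row minus the weight which the previous shape prescribes for that row. Coefficients are
-- compared at a fixed exponent α, where only letters up to `n = length α` occur. For the tabloids
-- in the sum this bound comes from the tableau: its shape is the weight of the tabloid, and a
-- tableau with letters at most n has at most n rows.

private variable
  l n : ℕ
  X : Set

-- Pairing two rows of a matrix

-- The common part is taken off both numbers and one remainder vanishes. Abstracting `b ∸ x`,
-- `x ∸ b` and `b ⊓ x` and matching on this turns truncated subtraction into addition.
split : ∀ b x → b ≡ b ⊓ x + (b ∸ x) × x ≡ b ⊓ x + (x ∸ b) × (b ∸ x ≡ 0 ⊎ x ∸ b ≡ 0)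
split zero    x       = sym (0∸n≡0 x) , refl , inj₁ (0∸n≡0 x)
split (suc b) zero    = refl , refl , inj₂ refl
split (suc b) (suc x) with split b x
... | p , q , r = cong suc p , cong suc q , r

-- A vector counts one letter in the rows of a tabloid, bottom row first: as counts the
-- letters i and bs the letters i + 1.  The state x is the number of letters i below
-- that are not yet paired with a letter i + 1.
raised paired : ℕ → Vec ℕ l → Vec ℕ l → Vec ℕ l
raised x []       []       = []
raised x (a ∷ as) (b ∷ bs) = (a + (b ∸ x)) ∷ raised (x ∸ b + a) as bs
paired x []       []       = []
paired x (a ∷ as) (b ∷ bs) = (b ⊓ x) ∷ paired (x ∸ b + a) as bs

-- All letters i + 1 are paired: the Yamanouchi condition for i and i + 1.
Dom : ℕ → Vec ℕ l → Vec ℕ l → Set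
Dom x []       []       = ⊤
Dom x (a ∷ as) (b ∷ bs) = b ≤ x × Dom (x ∸ b + a) as bs

bottom : Vec ℕ l → ℕ
bottom []      = 0
bottom (x ∷ _) = x

grow : Vec ℕ l → Vec ℕ l → Vec ℕ l
grow []       []       = []
grow (a ∷ as) (p ∷ ps) = (a + (p ⊔ bottom (grow as ps))) ∷ grow as ps

-- The truncation is harmless: `a + (τ ∸ (r + a))` is `a ⊔ (τ ∸ r)`, and this `a` is absorbed by
-- `a + (p ⊔ s)`. Followed by `lowered-step` it computes one row of `between`.
raised-step : ∀ a c p s τ r →
  (a + c) + (p ⊔ (s ⊔ (τ ∸ (r + a)))) ≡ c + ((a + (p ⊔ s)) ⊔ (τ ∸ r))
raised-step a c p s τ r = begin
  (a + c) + (p ⊔ (s ⊔ (τ ∸ (r + a))))       ≡⟨ cong (_+ (p ⊔ (s ⊔ (τ ∸ (r + a))))) (+-comm a c) ⟩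
  (c + a) + (p ⊔ (s ⊔ (τ ∸ (r + a))))       ≡⟨ +-assoc c a _ ⟩
  c + (a + (p ⊔ (s ⊔ (τ ∸ (r + a)))))       ≡⟨ cong (λ y → c + (a + y)) (sym (⊔-assoc p s _)) ⟩
  c + (a + ((p ⊔ s) ⊔ (τ ∸ (r + a))))       ≡⟨ cong (c +_) (+-distribˡ-⊔ a (p ⊔ s) _) ⟩
  c + ((a + (p ⊔ s)) ⊔ (a + (τ ∸ (r + a)))) ≡⟨ cong (λ y → c + ((a + (p ⊔ s)) ⊔ (a + y))) (sym (∸-+-assoc τ r a)) ⟩
  c + ((a + (p ⊔ s)) ⊔ (a + (τ ∸ r ∸ a)))   ≡⟨ cong (λ y → c + ((a + (p ⊔ s)) ⊔ y)) (sym (m⊔n≡m+n∸m a (τ ∸ r))) ⟩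
  c + ((a + (p ⊔ s)) ⊔ (a ⊔ (τ ∸ r)))       ≡⟨ cong (c +_) (sym (⊔-assoc (a + (p ⊔ s)) a _)) ⟩
  c + (((a + (p ⊔ s)) ⊔ a) ⊔ (τ ∸ r))       ≡⟨ cong (λ y → c + (y ⊔ (τ ∸ r))) (m≥n⇒m⊔n≡m (m≤m+n a _)) ⟩
  c + ((a + (p ⊔ s)) ⊔ (τ ∸ r))             ∎
  where
  open ≡-Reasoning
  m⊔n≡m+n∸m : ∀ m n → m ⊔ n ≡ m + (n ∸ m)
  m⊔n≡m+n∸m zero    n       = refl
  m⊔n≡m+n∸m (suc m) zero    = cong suc (sym (+-identityʳ m))
  m⊔n≡m+n∸m (suc m) (suc n) = cong suc (m⊔n≡m+n∸m m n)

lowered-step : ∀ b x σ τ →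
  (b ∸ x) + (σ ⊔ (τ ∸ (x ∸ b))) ≡ σ ⊔ ((b + (σ ⊔ τ)) ∸ x)
lowered-step b x σ τ with b ∸ x | x ∸ b | b ⊓ x | split b x
... | c | .0 | m | refl , refl , inj₂ refl = begin
  c + (σ ⊔ τ)                         ≡⟨ sym (m≤n⇒m⊔n≡n (≤-trans (m≤m⊔n σ τ) (m≤n+m _ c))) ⟩
  σ ⊔ (c + (σ ⊔ τ))                   ≡⟨ cong (σ ⊔_)
      (sym (trans (cong₂ _∸_ (+-assoc m c _) (+-identityʳ m)) (m+n∸m≡n m _))) ⟩
  σ ⊔ ((m + c + (σ ⊔ τ)) ∸ (m + 0))   ∎
  where open ≡-Reasoning
... | .0 | s | m | refl , refl , inj₁ refl = begin
  σ ⊔ (τ ∸ s)                         ≡⟨ cong (_⊔ (τ ∸ s)) (sym (m≥n⇒m⊔n≡m (m∸n≤m σ s))) ⟩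
  (σ ⊔ (σ ∸ s)) ⊔ (τ ∸ s)             ≡⟨ ⊔-assoc σ _ _ ⟩
  σ ⊔ ((σ ∸ s) ⊔ (τ ∸ s))             ≡⟨ cong (σ ⊔_) (sym (∸-distribʳ-⊔ s σ τ)) ⟩
  σ ⊔ ((σ ⊔ τ) ∸ s)                   ≡⟨ cong (σ ⊔_)
      (sym (trans (cong (λ y → (y + (σ ⊔ τ)) ∸ (m + s)) (+-identityʳ m)) ([m+n]∸[m+o]≡n∸o m (σ ⊔ τ) s))) ⟩
  σ ⊔ ((m + 0 + (σ ⊔ τ)) ∸ (m + s))   ∎
  where open ≡-Reasoning

paired-step : ∀ b x σ τ →
  b ⊓ x + (((b ∸ x) + (σ ⊔ (τ ∸ (x ∸ b)))) ⊔ τ) ≡ b + (σ ⊔ τ)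
paired-step b x σ τ with b ∸ x | x ∸ b | b ⊓ x | split b x
... | c | .0 | m | refl , refl , inj₂ refl = begin
  m + ((c + (σ ⊔ τ)) ⊔ τ)  ≡⟨ cong (m +_) (m≥n⇒m⊔n≡m (≤-trans (m≤n⊔m σ τ) (m≤n+m _ c))) ⟩
  m + (c + (σ ⊔ τ))        ≡⟨ sym (+-assoc m c _) ⟩
  m + c + (σ ⊔ τ)          ∎
  where open ≡-Reasoning
... | .0 | s | m | refl , refl , inj₁ refl = begin
  m + ((σ ⊔ (τ ∸ s)) ⊔ τ)  ≡⟨ cong (m +_) (⊔-assoc σ _ _) ⟩
  m + (σ ⊔ ((τ ∸ s) ⊔ τ))  ≡⟨ cong (λ y → m + (σ ⊔ y)) (m≤n⇒m⊔n≡n (m∸n≤m τ s)) ⟩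
  m + (σ ⊔ τ)              ≡⟨ cong (_+ (σ ⊔ τ)) (sym (+-identityʳ m)) ⟩
  m + 0 + (σ ⊔ τ)          ∎
  where open ≡-Reasoning

-- If as and bs lead from ps through σ to τ, then after raising, the shape in the middle
-- is max (σ j, τ j - xⱼ), where xⱼ is the state at row j.
between : ℕ → Vec ℕ l → Vec ℕ l → Vec ℕ l → Vec ℕ l
between x []       []       []       = []
between x (a ∷ as) (b ∷ bs) (p ∷ ps) =
  (bottom (grow (a ∷ as) (p ∷ ps)) ⊔ (bottom (grow (b ∷ bs) (grow (a ∷ as) (p ∷ ps))) ∸ x))
  ∷ between (x ∸ b + a) as bs ps

bottom-between : ∀ x (as bs ps : Vec ℕ l) →
  bottom (between x as bs ps) ≡ bottom (grow as ps) ⊔ (bottom (grow bs (grow as ps)) ∸ x)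
bottom-between x []       []       []       = sym (0∸n≡0 x)
bottom-between x (a ∷ as) (b ∷ bs) (p ∷ ps) = refl

grow-raised : ∀ x (as bs ps : Vec ℕ l) → grow (raised x as bs) ps ≡ between x as bs ps
grow-raised x []       []       []       = refl
grow-raised x (a ∷ as) (b ∷ bs) (p ∷ ps) with grow (raised (x ∸ b + a) as bs) ps | grow-raised (x ∸ b + a) as bs ps
... | _ | refl rewrite bottom-between (x ∸ b + a) as bs ps = cong (_∷ _) (trans
  (raised-step a (b ∸ x) p (bottom (grow as ps)) (bottom (grow bs (grow as ps))) (x ∸ b))
  (lowered-step b x _ _))

grow-paired : ∀ x (as bs ps : Vec ℕ l) → grow (paired x as bs) (between x as bs ps) ≡ grow bs (grow as ps)
grow-paired x []       []       []       = refl
grow-paired x (a ∷ as) (b ∷ bs) (p ∷ ps)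
  rewrite grow-paired (x ∸ b + a) as bs ps
        | sym (lowered-step b x (a + (p ⊔ bottom (grow as ps))) (bottom (grow bs (grow as ps))))
        = cong (_∷ grow bs (grow as ps)) (paired-step b x _ _)

grow-exchange : ∀ x (as bs ps : Vec ℕ l) →
  grow (paired x as bs) (grow (raised x as bs) ps) ≡ grow bs (grow as ps)
grow-exchange x as bs ps rewrite grow-raised x as bs ps = grow-paired x as bs ps

Dom-paired : ∀ x (as bs : Vec ℕ l) → Dom x as (paired x as bs)
Dom-paired x []       []       = tt
Dom-paired x (a ∷ as) (b ∷ bs) =
  m⊓n≤n b x , subst (λ y → Dom (y + a) as (paired (x ∸ b + a) as bs)) eq (Dom-paired (x ∸ b + a) as bs)
  where
  eq : x ∸ b ≡ x ∸ b ⊓ x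
  eq = sym (trans (∸-distribˡ-⊓-⊔ x b x) (trans (cong (x ∸ b ⊔_) (n∸n≡0 x)) (⊔-identityʳ _)))

Dom-mono : ∀ {x y} (as bs : Vec ℕ l) → x ≤ y → Dom x as bs → Dom y as bs
Dom-mono []       []       x≤y _       = tt
Dom-mono (a ∷ as) (b ∷ bs) x≤y (p , q) =
  ≤-trans p x≤y , Dom-mono as bs (+-monoˡ-≤ a (∸-monoˡ-≤ b x≤y)) q

-- Raising adds letters `i` and removes letters `i + 1`, so the state never falls below the old one,
-- which already covers every paired letter.
Dom-raised-paired : ∀ {x y} (as bs : Vec ℕ l) → x ≤ y → Dom y (raised x as bs) (paired x as bs)
Dom-raised-paired []       []       _ = tt
Dom-raised-paired {x = x} {y} (a ∷ as) (b ∷ bs) x≤y =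
  ≤-trans (m⊓n≤n b x) x≤y ,
  Dom-raised-paired as bs (+-mono-≤ (∸-mono x≤y (m⊓n≤m b x)) (m≤m+n a _))

-- `paired w ps bs` is `bs` with some letters taken away, and a larger supply can only help the
-- pairing. `insert-surjective` uses it to pass from a row after insertion to the row before its
-- last pairing.
Dom-unpaired : ∀ {x y} w (ps bs cs : Vec ℕ l) → x ≤ y → Dom x (paired w ps bs) cs → Dom y bs cs
Dom-unpaired w []       []       []       _   _       = tt
Dom-unpaired w (p ∷ ps) (b ∷ bs) (c ∷ cs) x≤y (q , r) =
  ≤-trans q x≤y ,
  Dom-unpaired (w ∸ b + p) ps bs cs (+-mono-≤ (∸-monoˡ-≤ c x≤y) (m⊓n≤m b w)) r

sum-conserved : ∀ x (as bs : Vec ℕ l) → Vec.sum (raised x as bs) + Vec.sum (paired x as bs) ≡ Vec.sum as + Vec.sum bs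
sum-conserved x []       []       = refl
sum-conserved x (a ∷ as) (b ∷ bs) with b ∸ x | x ∸ b | b ⊓ x | split b x
... | c | s | m | refl , eq , _ = begin
  (a + c + Vec.sum R) + (m + Vec.sum P) ≡⟨ lemma a c (Vec.sum R) m (Vec.sum P) ⟩
  a + (m + c) + (Vec.sum R + Vec.sum P) ≡⟨ cong (a + (m + c) +_) (sum-conserved (s + a) as bs) ⟩
  a + (m + c) + (Vec.sum as + Vec.sum bs) ≡⟨ lemma′ a (m + c) (Vec.sum as) (Vec.sum bs) ⟩
  (a + Vec.sum as) + (m + c + Vec.sum bs) ∎
  where
  open ≡-Reasoning
  R = raised (s + a) as bs
  P = paired (s + a) as bs
  lemma : ∀ a c r m p → (a + c + r) + (m + p) ≡ a + (m + c) + (r + p)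
  lemma = solve-∀
  lemma′ : ∀ a b c d → a + b + (c + d) ≡ (a + c) + (b + d)
  lemma′ = solve-∀

sum-raised : ∀ x (as bs : Vec ℕ l) → Vec.sum as ≤ Vec.sum (raised x as bs)
sum-raised x []       []       = z≤n
sum-raised x (a ∷ as) (b ∷ bs) = +-mono-≤ (m≤m+n a _) (sum-raised _ as bs)

-- Every paired letter uses up a letter of the stock `x` or of `as`.
sum-paired : ∀ x (as bs : Vec ℕ l) → Vec.sum (paired x as bs) ≤ x + Vec.sum as
sum-paired x []       []       = z≤n
sum-paired x (a ∷ as) (b ∷ bs) with b ∸ x | x ∸ b | b ⊓ x | split b x
... | c | s | m | _ , refl , _ = ≤-trans (+-monoʳ-≤ m (sum-paired (s + a) as bs))
  (≤-reflexive (lemma m s a (Vec.sum as)))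
  where
  lemma : ∀ m s a t → m + (s + a + t) ≡ m + s + (a + t)
  lemma = solve-∀

sum-paired≤ : ∀ x (as bs : Vec ℕ l) → Vec.sum (paired x as bs) ≤ Vec.sum bs
sum-paired≤ x []       []       = z≤n
sum-paired≤ x (a ∷ as) (b ∷ bs) = +-mono-≤ (m⊓n≤m b x) (sum-paired≤ _ as bs)

private
  -- The new offset is `d + c - e`, expressed without subtraction. If `e` is 0, it is `c + d`; if
  -- `r` is 0, the bound on `a` keeps `k + d - a` from being negative.
  offset : ∀ a c d {k e r} → a + c ≡ k + e → e ≡ 0 ⊎ r ≡ 0 → a ≤ k + r + d →
           ∃ λ d′ → (k + r + d ∸ a ≡ r + d′) × (a + d′ ≡ k + d)
  offset a c d {k} _ (inj₂ refl) a≤ =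
    k + 0 + d ∸ a , refl , trans (m+[n∸m]≡n a≤) (cong (_+ d) (+-identityʳ k))
  offset a c d {k} {r = r} eq (inj₁ refl) a≤ with refl ← trans eq (+-identityʳ k) =
    c + d , trans (cong (_∸ a) (lem a c r d)) (m+n∸m≡n a _) , sym (+-assoc a c d)
    where
    lem : ∀ a c r d → a + c + r + d ≡ a + (r + (c + d))
    lem = solve-∀

-- First the second letter is raised into the first one (as, bs), then the result into
-- the letter ps.  The offset d is the difference of the numbers of letters raised so far.
Dom-insert : ∀ x y d (ps as bs : Vec ℕ l) → Dom (y + d) ps as →
  Dom (x + d) (paired y ps (raised x as bs)) (paired x as bs) ×
  Vec.sum as ≤ Vec.sum (paired y ps (raised x as bs)) + d
Dom-insert x y d []       []       []       _ = tt , z≤n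
Dom-insert x y d (p ∷ ps) (a ∷ as) (b ∷ bs) (a≤ , dom)
  with b ∸ x | x ∸ b | b ⊓ x | split b x
... | c | s | m | refl , refl , _ with a + c ∸ y | y ∸ (a + c) | (a + c) ⊓ y | split (a + c) y
...   | e | r | k | eq₁ , refl , alt =
  (≤-trans (m≤m+n m s) (m≤m+n (m + s) d) ,
   subst (λ z → Dom z (paired (r + p) ps (raised (s + a) as bs)) (paired (s + a) as bs)) (sym next) (proj₁ ih)) ,
  (begin
    a + Vec.sum as           ≤⟨ +-monoʳ-≤ a (proj₂ ih) ⟩
    a + (Q + d′)         ≡⟨ lemma₁ a Q d′ ⟩
    (a + d′) + Q         ≡⟨ cong (_+ Q) (proj₂ (proj₂ delay)) ⟩
    (k + d) + Q          ≡⟨ lemma₂ k d Q ⟩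
    k + Q + d            ∎)
  where
  open ≤-Reasoning
  lemma₁ : ∀ a q d → a + (q + d) ≡ (a + d) + q
  lemma₁ = solve-∀
  lemma₂ : ∀ k d q → (k + d) + q ≡ k + q + d
  lemma₂ = solve-∀
  delay = offset a c d eq₁ alt a≤
  d′ = proj₁ delay
  ih = Dom-insert (s + a) (r + p) d′ ps as bs
    (subst (λ z → Dom z ps as)
      (trans (cong (_+ p) (proj₁ (proj₂ delay))) (lem r d′ p)) dom)
    where
    lem : ∀ r d p → r + d + p ≡ r + p + d
    lem = solve-∀
  Q = Vec.sum (paired (r + p) ps (raised (s + a) as bs))
  -- The state of the new pair remains the state of `as` and `bs` plus the current offset.
  next : m + s + d ∸ m + k ≡ s + a + d′
  next = trans (cong (_+ k) (trans (cong (_∸ m) (+-assoc m s d)) (m+n∸m≡n m _)))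
    (trans (trans (+-assoc s d k) (cong (s +_) (trans (+-comm d k) (sym (proj₂ (proj₂ delay)))))) (sym (+-assoc s a d′)))

private
  -- Once x exceeds q, no letter bs is raised any more, so x stays ahead.
  sum-overtaken : ∀ x q w (ps as bs : Vec ℕ l) →
    Dom q (paired w ps (raised x as bs)) (paired x as bs) → q < x →
    Vec.sum (paired w ps (raised x as bs)) ≤ Vec.sum as
  sum-overtaken x q w []       []       []       _         _   = z≤n
  sum-overtaken x q w (p ∷ ps) (a ∷ as) (b ∷ bs) (b≤ , dom) q<x
    with b ∸ x | x ∸ b | b ⊓ x | split b x
  ... | c | .0 | m | refl , refl , inj₂ refl =
    contradiction (≤-trans q<x (≤-trans (≤-reflexive (+-identityʳ m)) b≤)) (<-irrefl refl)
  ... | .0 | s | m | refl , refl , inj₁ refl = +-mono-≤ k≤a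
    (sum-overtaken (s + a) (q ∸ m + k) (w ∸ (a + 0) + p) ps as bs dom
      (+-mono-<-≤ (≤-trans (∸-monoˡ-< q<x b≤) (≤-reflexive (m+n∸m≡n m s))) k≤a))
    where
    k = (a + 0) ⊓ w
    k≤a : k ≤ a
    k≤a = ≤-trans (m⊓n≤m _ w) (≤-reflexive (+-identityʳ a))

-- This reverses `Dom-insert`. The offset would become negative only if `a` exceeded `k + d`. From
-- then on `sum-overtaken` bounds the sum of the remaining paired letters by the sum of the
-- remaining `as`, so the deficit could never be made up, against the inequality of sums.
Dom-extract : ∀ x w d (ps as bs : Vec ℕ l) →
  Dom (x + d) (paired w ps (raised x as bs)) (paired x as bs) →
  Vec.sum as ≤ Vec.sum (paired w ps (raised x as bs)) + d →
  Dom (w + d) ps as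
Dom-extract x w d []       []       []       _          _ = tt
Dom-extract x w d (p ∷ ps) (a ∷ as) (b ∷ bs) (b≤ , dom) ∑≤
  with b ∸ x | x ∸ b | b ⊓ x | split b x
... | c | s | m | refl , refl , _ with a + c ∸ w | w ∸ (a + c) | (a + c) ⊓ w | split (a + c) w
...   | e | r | k | eq₁ , refl , alt with a ≤? k + d
...     | yes a≤k+d =
  ≤-trans a≤k+d (+-monoˡ-≤ d (m≤m+n k r)) ,
  subst (λ z → Dom z ps as) next₁ (Dom-extract (s + a) (r + p) d′ ps as bs
    (subst (λ z → Dom z H B) next₂ dom)
    (+-cancelˡ-≤ a _ _ (≤-trans ∑≤ (≤-reflexive ∑≡))))
  where
  d′ = k + d ∸ a
  H = paired (r + p) ps (raised (s + a) as bs)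
  B = paired (s + a) as bs
  a+d′ : a + d′ ≡ k + d
  a+d′ = m+[n∸m]≡n a≤k+d
  lem₁ : ∀ k r d → k + r + d ≡ r + (k + d)
  lem₁ = solve-∀
  lem₂ : ∀ r d p → r + p + d ≡ r + d + p
  lem₂ = solve-∀
  lem₃ : ∀ r a d → r + (a + d) ≡ a + (r + d)
  lem₃ = solve-∀
  next₁ : r + p + d′ ≡ k + r + d ∸ a + p
  next₁ = trans (lem₂ r d′ p) (cong (_+ p) (sym (trans (cong (_∸ a)
    (trans (lem₁ k r d) (trans (cong (r +_) (sym a+d′)) (lem₃ r a d′)))) (m+n∸m≡n a _))))
  next₂ : m + s + d ∸ m + k ≡ s + a + d′
  next₂ = trans (cong (_+ k) (trans (cong (_∸ m) (+-assoc m s d)) (m+n∸m≡n m _)))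
    (trans (trans (+-assoc s d k) (cong (s +_) (trans (+-comm d k) (sym a+d′)))) (sym (+-assoc s a d′)))
  ∑≡ : k + Vec.sum H + d ≡ a + (Vec.sum H + d′)
  ∑≡ = trans (lem₂ k d (Vec.sum H)) (trans (cong (_+ Vec.sum H) (sym a+d′))
    (trans (+-assoc a d′ _) (cong (a +_) (+-comm d′ _))))
...     | no  a≰k+d = contradiction ∑≤ (<⇒≱ (begin-strict
  k + Vec.sum H + d     ≡⟨ lem k (Vec.sum H) d ⟩
  (k + d) + Vec.sum H   <⟨ +-monoˡ-< (Vec.sum H) k+d<a ⟩
  a + Vec.sum H         ≤⟨ +-monoʳ-≤ a (sum-overtaken (s + a) _ (r + p) ps as bs dom
    (≤-trans (s≤s (≤-reflexive next)) (≤-trans (≤-reflexive (sym (+-suc s (k + d)))) (+-monoʳ-≤ s k+d<a)))) ⟩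
  a + Vec.sum as        ∎))
  where
  open ≤-Reasoning
  H = paired (r + p) ps (raised (s + a) as bs)
  k+d<a = ≰⇒> a≰k+d
  lem : ∀ k h d → k + h + d ≡ (k + d) + h
  lem = solve-∀
  lem′ : ∀ s d k → s + d + k ≡ s + (k + d)
  lem′ = solve-∀
  next : m + s + d ∸ m + k ≡ s + (k + d)
  next = trans (cong (_+ k) (trans (cong (_∸ m) (+-assoc m s d)) (m+n∸m≡n m _))) (lem′ s d k)

-- Insertion

private
  -- Since `c` or `s` is 0, `u` is the smaller of `u + c` and `u + s`.
  ⊓≡0-unique : ∀ {u c s u′ c′ s′} → u + c ≡ u′ + c′ → u + s ≡ u′ + s′ →
               c ≡ 0 ⊎ s ≡ 0 → c′ ≡ 0 ⊎ s′ ≡ 0 → u ≡ u′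
  ⊓≡0-unique {u} {c} {s} {u′} {c′} {s′} p q alt alt′ = ≤-antisym (below u p q alt′) (below u′ (sym p) (sym q) alt)
    where
    below : ∀ u {c s u′ c′ s′} → u + c ≡ u′ + c′ → u + s ≡ u′ + s′ → c′ ≡ 0 ⊎ s′ ≡ 0 → u ≤ u′
    below u p q (inj₁ refl) = ≤-trans (m≤m+n u _) (≤-reflexive (trans p (+-identityʳ _)))
    below u p q (inj₂ refl) = ≤-trans (m≤m+n u _) (≤-reflexive (trans q (+-identityʳ _)))

  cancel-paired : ∀ m u û {s ŝ} → u + (m + s) ≡ û + (m + ŝ) → u + s ≡ û + ŝ
  cancel-paired m u û {s} {ŝ} eq = +-cancelˡ-≡ m _ _ (trans (lem m u s) (trans eq (sym (lem m û ŝ))))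
    where
    lem : ∀ m u s → m + (u + s) ≡ u + (m + s)
    lem = solve-∀

  state-step : ∀ m u û a â {c ĉ s ŝ} → a + c ≡ â + ĉ → u + (m + s) ≡ û + (m + ŝ) →
               (u + c) + (s + a) ≡ (û + ĉ) + (ŝ + â)
  state-step m u û a â {c} {ĉ} {s} {ŝ} a′≡ eq =
    trans (lem u c s a) (trans (cong₂ _+_ (cancel-paired m u û eq) a′≡) (sym (lem û ĉ ŝ â)))
    where
    lem : ∀ u c s a → (u + c) + (s + a) ≡ (u + s) + (a + c)
    lem = solve-∀

  total-step : ∀ a â {c ĉ t t̂ u û} → a + c ≡ â + ĉ → (a + t) + û ≡ (â + t̂) + u →
               t + (û + ĉ) ≡ t̂ + (u + c)
  total-step a â {c} {ĉ} {t} {t̂} {u} {û} a′≡ eq = +-cancelˡ-≡ (a + c) _ _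
    (trans (lem a c t û ĉ) (trans (cong₂ _+_ eq (+-comm c ĉ))
    (trans (sym (lem â ĉ t̂ u c)) (cong (_+ (t̂ + (u + c))) (sym a′≡)))))
    where
    lem : ∀ a c t u d → (a + c) + (t + (u + d)) ≡ (a + t + u) + (c + d)
    lem = solve-∀

-- u is the number of letters raised in the rows below, which makes u + x the state of
-- Dom for the raised vectors; the sums fix the total number of letters raised.
raising-injective : ∀ x x̂ u û (as bs âs b̂s : Vec ℕ l) →
  raised x as bs ≡ raised x̂ âs b̂s → paired x as bs ≡ paired x̂ âs b̂s →
  u + x ≡ û + x̂ → Vec.sum as + û ≡ Vec.sum âs + u →
  as ≡ âs × bs ≡ b̂s × u ≡ û
raising-injective x x̂ u û []       []       []       []         _  _  _  ∑ = refl , refl , sym ∑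
raising-injective x x̂ u û (a ∷ as) (b ∷ bs) (â ∷ âs) (b̂ ∷ b̂s) R≡ P≡ z≡ ∑
  with b ∸ x | x ∸ b | b ⊓ x | split b x | b̂ ∸ x̂ | x̂ ∸ b̂ | b̂ ⊓ x̂ | split b̂ x̂
... | c | s | m | refl , refl , alt | ĉ | ŝ | m̂ | refl , refl , alt̂
  with a′≡ , R′≡ ← ∷-injective R≡ | refl , P′≡ ← ∷-injective P≡
  -- The number of raised letters is settled at the top, where the sums fix it, and then carried
  -- down row by row.
  with refl , refl , u₁≡ ← raising-injective (s + a) (ŝ + â) (u + c) (û + ĉ) as bs âs b̂s R′≡ P′≡
    (state-step m u û a â a′≡ z≡) (total-step a â a′≡ ∑)
  with refl ← ⊓≡0-unique {u} {c} {s} {û} {ĉ} {ŝ} u₁≡ (cancel-paired m u û z≡) alt alt̂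
  with refl ← +-cancelˡ-≡ u _ _ u₁≡
  with refl ← +-cancelʳ-≡ c a â a′≡ = refl , refl , refl

private
  cancel-head : ∀ b {k t a s r} → k + (b + s) ≤ (b + t) + (a + r) → k + s ≤ (t + a) + r
  cancel-head b {k} {t} {a} {s} {r} k≤ = +-cancelˡ-≤ b _ _
    (≤-trans (≤-reflexive (lem b k s)) (≤-trans k≤ (≤-reflexive (lem′ b t a r))))
    where
    lem : ∀ b k s → b + (k + s) ≡ k + (b + s)
    lem = solve-∀
    lem′ : ∀ b t a r → (b + t) + (a + r) ≡ b + ((t + a) + r)
    lem′ = solve-∀

-- Here `k` is the number of letters raised in all rows together, those below included. The
-- inequality of sums says that the state after the top row is at least `k`, so the descent can
-- start there with `u = k`. In a row that leaves `t` letters unpaired, the excess of `u₁` over `t`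
-- is turned back, and the smaller of the two numbers is passed down.
raising-surjective : ∀ z k (as′ bs′ : Vec ℕ l) → Dom z as′ bs′ → k + Vec.sum bs′ ≤ z + Vec.sum as′ →
  ∃₂ λ as bs → ∃₂ λ x u → z ≡ u + x × raised x as bs ≡ as′ × paired x as bs ≡ bs′ ×
                          Vec.sum as + k ≡ Vec.sum as′ + u
raising-surjective z k [] [] _ k≤ =
  [] , [] , z ∸ k , k ,
  sym (m+[n∸m]≡n (≤-trans (m≤m+n k 0) (≤-trans k≤ (≤-reflexive (+-identityʳ z))))) , refl , refl , refl
raising-surjective z k (a′ ∷ as′) (b′ ∷ bs′) (b′≤z , dom) k≤
  with t , refl ← m≤n⇒∃[o]m+o≡n b′≤z
  with as , bs , x₁ , u₁ , z₁≡ , refl , refl , ∑≡ ←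
    raising-surjective (t + a′) k as′ bs′ (subst (λ y → Dom (y + a′) as′ bs′) (m+n∸m≡n b′ t) dom)
      (cancel-head b′ {k} k≤)
  with ≤-total u₁ t
... | inj₁ u₁≤t = a′ ∷ as , b′ ∷ bs , b′ + (t ∸ u₁) , u₁ , z≡ ,
  cong₂ _∷_ (trans (cong (a′ +_) (m≤n⇒m∸n≡0 (m≤m+n b′ _))) (+-identityʳ a′)) (cong (λ y → raised y as bs) next) ,
  cong₂ _∷_ (m≤n⇒m⊓n≡m (m≤m+n b′ _)) (cong (λ y → paired y as bs) next) ,
  trans (+-assoc a′ _ k) (trans (cong (a′ +_) ∑≡) (sym (+-assoc a′ _ u₁)))
  where
  z≡ : b′ + t ≡ u₁ + (b′ + (t ∸ u₁))
  z≡ = trans (cong (b′ +_) (sym (m+[n∸m]≡n u₁≤t))) (lem₁ b′ u₁ (t ∸ u₁))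
    where
    lem₁ : ∀ b u t → b + (u + t) ≡ u + (b + t)
    lem₁ = solve-∀
  next : b′ + (t ∸ u₁) ∸ b′ + a′ ≡ x₁
  next = trans (cong (_+ a′) (m+n∸m≡n b′ _)) (+-cancelˡ-≡ u₁ _ _
    (trans (sym (+-assoc u₁ _ a′)) (trans (cong (_+ a′) (m+[n∸m]≡n u₁≤t)) z₁≡)))
... | inj₂ t≤u₁ with c , refl ← m≤n⇒∃[o]m+o≡n t≤u₁
  with refl ← +-cancelˡ-≡ t a′ (c + x₁) (trans z₁≡ (+-assoc t c x₁)) =
  x₁ ∷ as , b′ + c ∷ bs , b′ , t , +-comm b′ t ,
  cong₂ _∷_ (trans (cong (x₁ +_) (m+n∸m≡n b′ c)) (+-comm x₁ c))
    (cong (λ y → raised (y + x₁) as bs) (m≤n⇒m∸n≡0 (m≤m+n b′ c))) ,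
  cong₂ _∷_ (m≥n⇒m⊓n≡n (m≤m+n b′ c)) (cong (λ y → paired (y + x₁) as bs) (m≤n⇒m∸n≡0 (m≤m+n b′ c))) ,
  trans (+-assoc x₁ _ k) (trans (cong (x₁ +_) ∑≡) (lem₂ x₁ _ t c))
  where
  lem₂ : ∀ x s t c → x + (s + (t + c)) ≡ (c + x + s) + t
  lem₂ = solve-∀

-- The letters n, …, 1 in this order.
Mat : ℕ → ℕ → Set
Mat n l = Vec (Vec ℕ l) n

weights : Mat n l → Vec ℕ n
weights = Vec.map Vec.sum

act : Mat n l → Vec ℕ l → Vec ℕ l
act []      p = p
act (v ∷ A) p = grow v (act A p)

-- The new row belongs to the largest letter. Its paired part keeps that letter, the rest joins the
-- row of the next smaller letter, and the row so enlarged is treated in the same way against the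
-- one after it.
insert : Vec ℕ l → Mat n l → Mat (suc n) l
insert v []      = v ∷ []
insert v (y ∷ Y) = paired 0 y v ∷ insert (raised 0 y v) Y

rsk : Mat n l → Mat n l
rsk []      = []
rsk (v ∷ A) = insert v (rsk A)

Yam : Mat n l → Set
Yam []          = ⊤
Yam (_ ∷ [])    = ⊤
Yam (b ∷ a ∷ Y) = Dom 0 a b × Yam (a ∷ Y)

Chain : ℕ → Set
Chain zero    = ⊤
Chain (suc n) = Vec ℕ (suc n) × Chain n

top : ∀ {n} → Chain n → Vec ℕ n
top {zero}  _       = []
top {suc n} (μ , _) = μ

-- Parts are listed from the last to the first, in the order of the letters in `Mat`.
Interlacing : Vec ℕ (suc n) → Vec ℕ n → Set
Interlacing (_ ∷ [])      []       = ⊤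
Interlacing (m ∷ m′ ∷ ms) (k ∷ ks) = m ≤ k × k ≤ m′ × Interlacing (m′ ∷ ms) ks

GT : ∀ {n} → Chain n → Set
GT {zero}  _       = ⊤
GT {suc n} (μ , C) = Interlacing μ (top C) × GT C

shapes : Mat n l → Chain n
shapes []      = tt
shapes (v ∷ A) = weights (rsk (v ∷ A)) , shapes A

act-insert : ∀ (v : Vec ℕ l) (Y : Mat n l) p → act (insert v Y) p ≡ grow v (act Y p)
act-insert v []      p = refl
act-insert v (y ∷ Y) p =
  trans (cong (grow (paired 0 y v)) (act-insert (raised 0 y v) Y p)) (grow-exchange 0 y v (act Y p))

act-rsk : ∀ (A : Mat n l) p → act (rsk A) p ≡ act A p
act-rsk []      p = refl
act-rsk (v ∷ A) p = trans (act-insert v (rsk A) p) (cong (grow v) (act-rsk A p))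

sum-insert : ∀ (v : Vec ℕ l) (Y : Mat n l) → Vec.sum (weights (insert v Y)) ≡ Vec.sum v + Vec.sum (weights Y)
sum-insert v []      = refl
sum-insert v (y ∷ Y) = begin
  Vec.sum P + Vec.sum (weights (insert R Y)) ≡⟨ cong (Vec.sum P +_) (sum-insert R Y) ⟩
  Vec.sum P + (Vec.sum R + w)                ≡⟨ lem (Vec.sum P) (Vec.sum R) w ⟩
  (Vec.sum R + Vec.sum P) + w                ≡⟨ cong (_+ w) (sum-conserved 0 y v) ⟩
  (Vec.sum y + Vec.sum v) + w                ≡⟨ lem (Vec.sum v) (Vec.sum y) w ⟨
  Vec.sum v + (Vec.sum y + w)                ∎
  where
  open ≡-Reasoning
  P = paired 0 y v
  R = raised 0 y v
  w = Vec.sum (weights Y)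
  lem : ∀ p r w → p + (r + w) ≡ (r + p) + w
  lem = solve-∀

Yam-insert : ∀ (v : Vec ℕ l) (Y : Mat n l) → Yam Y → Yam (insert v Y)
Yam-insert v []          _         = tt
Yam-insert v (y ∷ [])    _         = Dom-raised-paired y v z≤n , tt
Yam-insert v (y ∷ p ∷ Y) (dom , r) =
  proj₁ (Dom-insert 0 0 0 p y v dom) , Yam-insert (raised 0 y v) (p ∷ Y) r

Yam-rsk : ∀ (A : Mat n l) → Yam (rsk A)
Yam-rsk []      = tt
Yam-rsk (v ∷ A) = Yam-insert v (rsk A) (Yam-rsk A)

Interlacing-insert : ∀ (v : Vec ℕ l) (Y : Mat n l) → Yam Y →
                     Interlacing (weights (insert v Y)) (weights Y)
Interlacing-insert v []          _         = tt
Interlacing-insert v (y ∷ [])    _         = sum-paired 0 y v , sum-raised 0 y v , tt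
Interlacing-insert v (y ∷ p ∷ Y) (dom , r) =
  sum-paired 0 y v ,
  ≤-trans (proj₂ (Dom-insert 0 0 0 p y v dom)) (≤-reflexive (+-identityʳ _)) ,
  Interlacing-insert (raised 0 y v) (p ∷ Y) r

top-shapes : ∀ (A : Mat n l) → top (shapes A) ≡ weights (rsk A)
top-shapes []      = refl
top-shapes (v ∷ A) = refl

GT-shapes : ∀ (A : Mat n l) → GT (shapes A)
GT-shapes []      = tt
GT-shapes (v ∷ A) =
  subst (Interlacing (weights (rsk (v ∷ A)))) (sym (top-shapes A)) (Interlacing-insert v (rsk A) (Yam-rsk A)) ,
  GT-shapes A

-- The weights of `Y` play the part of the recording tableau: they tell how many letters were raised
-- at each stage of the insertion.
insert-injective : ∀ (v v̂ : Vec ℕ l) (Y Ŷ : Mat n l) → insert v Y ≡ insert v̂ Ŷ →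
                   weights Y ≡ weights Ŷ → v ≡ v̂ × Y ≡ Ŷ
insert-injective v v̂ []      []      eq _  = proj₁ (∷-injective eq) , refl
insert-injective v v̂ (y ∷ Y) (ŷ ∷ Ŷ) eq ws
  with P≡ , eq′ ← ∷-injective eq | w≡ , ws′ ← ∷-injective ws
  with R≡ , refl ← insert-injective _ _ Y Ŷ eq′ ws′
  with refl , refl , _ ← raising-injective 0 0 0 0 y v ŷ v̂ R≡ P≡ refl (cong (_+ 0) w≡) = refl , refl

rsk-injective : ∀ (A B : Mat n l) → rsk A ≡ rsk B → shapes A ≡ shapes B → A ≡ B
rsk-injective []      []      _  _  = refl
rsk-injective (v ∷ A) (w ∷ B) eq cs with refl , Y≡ ← insert-injective v w (rsk A) (rsk B) eq
  (trans (sym (top-shapes A)) (trans (cong (λ C → top (proj₂ C)) cs) (top-shapes B)))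
  = cong (v ∷_) (rsk-injective A B Y≡ (cong proj₂ cs))

-- The stages of `insert` are undone in the opposite order, beginning at letter 1. Since `ks`
-- prescribes the weight `k` of the recovered row, `Vec.sum y′ ∸ k` letters must be turned back, and
-- interlacing makes this number admissible.
insert-surjective : ∀ (Z : Mat (suc n) l) ks → Yam Z → Interlacing (weights Z) ks →
                    ∃₂ λ v (Y : Mat n l) → insert v Y ≡ Z × weights Y ≡ ks × Yam Y
insert-surjective (z ∷ [])     []       _           _                = z , [] , refl , refl , tt
insert-surjective (z ∷ h ∷ Z) (k ∷ ks) (dom , yam) (z≤k , k≤h , int)
  with insert-surjective (h ∷ Z) ks yam int
... | y′ , [] , refl , refl , _ with
  raising-surjective 0 (Vec.sum y′ ∸ k) y′ z dom
    (≤-trans (+-monoʳ-≤ (Vec.sum y′ ∸ k) z≤k) (≤-reflexive (m∸n+n≡m k≤h)))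
... | a , v , 0 , 0 , _ , refl , refl , ∑≡ =
  v , a ∷ [] , refl ,
  cong (_∷ []) (+-cancelʳ-≡ (Vec.sum y′ ∸ k) _ _ (trans ∑≡ (trans (+-identityʳ _) (sym (m+[n∸m]≡n k≤h))))) , tt
insert-surjective (z ∷ h ∷ Z) (k ∷ ks) (dom , yam) (z≤k , k≤h , int)
    | y′ , p ∷ Y , refl , refl , yam′ with
  raising-surjective 0 (Vec.sum y′ ∸ k) y′ z (Dom-unpaired 0 p y′ z z≤n dom)
    (≤-trans (+-monoʳ-≤ (Vec.sum y′ ∸ k) z≤k) (≤-reflexive (m∸n+n≡m (≤-trans k≤h (sum-paired≤ 0 p y′)))))
... | a , v , 0 , 0 , _ , refl , refl , ∑≡ =
  v , a ∷ p ∷ Y , refl , cong (_∷ weights (p ∷ Y)) a≡k ,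
  -- The interlacing inequality `k≤h` is the inequality of sums that keeps the recovered rows
  -- Yamanouchi.
  Dom-extract 0 0 0 p a v dom (≤-trans (≤-reflexive a≡k) (≤-trans k≤h (m≤m+n _ 0))) , yam′
  where
  a≡k : Vec.sum a ≡ k
  a≡k = +-cancelʳ-≡ (Vec.sum y′ ∸ k) _ _ (trans ∑≡ (trans (+-identityʳ _)
    (sym (m+[n∸m]≡n (≤-trans k≤h (sum-paired≤ 0 p y′))))))

rsk-surjective : ∀ (Y : Mat n l) (C : Chain n) → Yam Y → GT C → top C ≡ weights Y →
                 ∃ λ A → rsk A ≡ Y × shapes A ≡ C
rsk-surjective {zero}  []  tt      _   _         _    = [] , refl , refl
rsk-surjective {suc n} Z   (μ , C) yam (int , gt) refl
  with v , Y , refl , ws , yam′ ← insert-surjective Z (top C) yam int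
  with A , refl , refl ← rsk-surjective Y C yam′ gt (sym ws) = v ∷ A , refl , refl

-- Rows of a filling

unique-length : ∀ {A : Set} {xs ys : List A} → Unique xs → Unique ys →
                (∀ x → x ∈ xs ⇔ x ∈ ys) → length xs ≡ length ys
unique-length p q eq = ↭-length (∼bag⇒↭ (unique∧set⇒bag p q λ {x} → eq x))

map-unique : ∀ {A B : Set} (f : A → B) {xs} → Unique xs →
             (∀ {x y} → x ∈ xs → y ∈ xs → f x ≡ f y → x ≡ y) → Unique (map f xs)
map-unique f []       inj = []
map-unique f (u ∷ us) inj =
  All.map⁺ (All.tabulate λ y∈ fx≡fy → All.lookup u y∈ (inj (here refl) (there y∈) fx≡fy)) ∷
  map-unique f us (λ x∈ y∈ → inj (there x∈) (there y∈))

applyUpTo-cong : ∀ {A : Set} {f h : ℕ → A} n → (∀ i → i < n → f i ≡ h i) → applyUpTo f n ≡ applyUpTo h n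
applyUpTo-cong zero    eq = refl
applyUpTo-cong (suc n) eq = cong₂ _∷_ (eq 0 z<s) (applyUpTo-cong n (λ i i<n → eq (suc i) (s<s i<n)))

Row : Set
Row = List Cell

Columns : ℕ → ℕ → Row → Set
Columns k d row = map column row ≡ applyUpTo (k +_) d

Columns-tail : ∀ {k d c v row} → Columns k d ((c , v) ∷ row) →
               ∃ λ d′ → d ≡ suc d′ × c ≡ k × Columns (suc k) d′ row
Columns-tail {k} {suc d} cols with c≡ , cols′ ← ∷ˡ-injective cols =
  d , refl , trans c≡ (+-identityʳ k) , trans cols′ (applyUpTo-cong d (λ i _ → +-suc k i))

column-bounds : ∀ {k d row c} → Columns k d row → c ∈ row → k ≤ column c × column c < k + d
column-bounds {k} {d} cols c∈ with i , i<d , eq ← ∈-applyUpTo⁻ (k +_) (subst (_ ∈_) cols (∈-map⁺ column c∈))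
  rewrite eq = m≤m+n k i , +-monoʳ-< k i<d

column-occupied : ∀ {k d row c} → Columns k d row → k ≤ c → c < k + d → ∃ λ v → (c , v) ∈ row
column-occupied {k} {d} cols k≤c c<k+d with i , refl ← m≤n⇒∃[o]m+o≡n k≤c
  with (_ , v) , v∈ , refl ← ∈-map⁻ column (subst (k + i ∈_) (sym cols) (∈-applyUpTo⁺ (k +_) (+-cancelˡ-< k i d c<k+d)))
  = v , v∈

Columns-unique : ∀ {k d row} → Columns k d row → Unique (map column row)
Columns-unique {k} {d} cols = subst Unique (sym cols)
  (Unique.applyUpTo⁺₁ (k +_) d λ i<j _ eq → <-irrefl (+-cancelˡ-≡ k _ _ eq) i<j)

Columns-length : ∀ {k d row} → Columns k d row → length row ≡ d
Columns-length {k} {d} {row} cols =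
  trans (sym (length-map column row)) (trans (cong length cols) (length-applyUpTo (k +_) d))

-- `a ⊔ k` clips the interval to the row, and truncated subtraction covers the case of an empty
-- interval.
count-interval : ∀ {P : Cell → Set} (P? : Decidable P) {k d} a b row → Columns k d row → b ≤ k + d →
                 (∀ {c} → c ∈ row → P c ⇔ (a ≤ column c × column c < b)) →
                 length (filter P? row) ≡ b ∸ (a ⊔ k)
count-interval P? {k} {zero}  a b [] cols b≤ P⇔ =
  sym (m≤n⇒m∸n≡0 (≤-trans b≤ (≤-trans (≤-reflexive (+-identityʳ k)) (m≤n⊔m a k))))
count-interval P? {k} {d} a b ((c , v) ∷ row) cols b≤ P⇔
  with d′ , refl , refl , cols′ ← Columns-tail {v = v} {row} cols
  with P? (k , v) | count-interval P? a b row cols′ (≤-trans b≤ (≤-reflexive (+-suc k d′))) (P⇔ ∘ there)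
... | yes p | ih with a≤k , k<b ← to (P⇔ (here refl)) p = begin
  suc (length (filter P? row)) ≡⟨ cong suc ih ⟩
  suc (b ∸ (a ⊔ suc k))        ≡⟨ cong (λ m → suc (b ∸ m)) (m≤n⇒m⊔n≡n (m≤n⇒m≤1+n a≤k)) ⟩
  suc (b ∸ suc k)              ≡⟨ sym (+-∸-assoc 1 k<b) ⟩
  b ∸ k                        ≡⟨ cong (b ∸_) (sym (m≤n⇒m⊔n≡n a≤k)) ⟩
  b ∸ (a ⊔ k)                  ∎
  where open ≡-Reasoning
... | no ¬p | ih with a ≤? k
...   | no a≰k = trans ih (cong (b ∸_) (trans (m≥n⇒m⊔n≡m (≰⇒> a≰k)) (sym (m≥n⇒m⊔n≡m (<⇒≤ (≰⇒> a≰k))))))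
...   | yes a≤k with k <? b
...     | yes k<b = contradiction (from (P⇔ (here refl)) (a≤k , k<b)) ¬p
...     | no  k≮b = trans ih (trans (m≤n⇒m∸n≡0 (≤-trans (≮⇒≥ k≮b) (≤-trans (n≤1+n k) (m≤n⊔m a (suc k)))))
                                    (sym (m≤n⇒m∸n≡0 (≤-trans (≮⇒≥ k≮b) (m≤n⊔m a k)))))

count≤ : ℕ → Row → ℕ
count≤ i row = length (filter (λ c → letter c ≤? i) row)

count≤-yes : ∀ {i v} c row → v ≤ i → count≤ i ((c , v) ∷ row) ≡ suc (count≤ i row)
count≤-yes c row v≤i = cong length (filter-accept (λ c → letter c ≤? _) v≤i)

count≤-no : ∀ {i v} c row → ¬ v ≤ i → count≤ i ((c , v) ∷ row) ≡ count≤ i row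
count≤-no c row v≰i = cong length (filter-reject (λ c → letter c ≤? _) v≰i)

count-yes : ∀ i w → count i (i ∷ w) ≡ suc (count i w)
count-yes i w = cong length (filter-accept (i ≟_) refl)

count-no : ∀ {i x} w → i ≢ x → count i (x ∷ w) ≡ count i w
count-no w i≢x = cong length (filter-reject (_ ≟_) i≢x)

-- In a sorted row on consecutive columns, the letters at most `i` form a prefix of length
-- `count≤ i row`.
letter≤⇔ : ∀ {k d row c v} i → Columns k d row → Linked (_≤_ on letter) row → (c , v) ∈ row →
           v ≤ i ⇔ c < k + count≤ i row
letter≤⇔ {k} {d} {(c₀ , w) ∷ row} {c} {v} i cols sorted c∈
  with d′ , refl , refl , cols′ ← Columns-tail {v = w} {row} cols
  with Linked.Linked⇒AllPairs ≤-trans sorted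
... | w≤ ∷ _ with w ≤? i
...   | no w≰i = subst (λ m → v ≤ i ⇔ c < k + m) (sym (trans (count≤-no k row w≰i) empty))
  (mk⇔ (λ v≤i → contradiction (≤-trans (All.lookup (≤-refl ∷ w≤) c∈) v≤i) w≰i)
       (λ c< → contradiction (≤-trans c< (≤-reflexive (+-identityʳ k))) (≤⇒≯ (proj₁ (column-bounds cols c∈)))))
  where
  empty : count≤ i row ≡ 0
  empty = cong length (filter-none (λ c → letter c ≤? i) {row} (All.map (λ w≤v v≤i → w≰i (≤-trans w≤v v≤i)) w≤))
...   | yes w≤i rewrite count≤-yes k row w≤i with c∈
...     | here refl = mk⇔ (λ _ → m<m+n k z<s) (λ _ → w≤i)
...     | there c∈′ = subst (λ m → v ≤ i ⇔ c < m) (sym (+-suc k _)) (letter≤⇔ i cols′ (Linked.tail sorted) c∈′)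

count≤-bound : ∀ {k d row} i → Columns k d row → k + count≤ i row ≤ k + d
count≤-bound {k} {row = row} i cols =
  +-monoʳ-≤ k (≤-trans (length-filter _ row) (≤-reflexive (Columns-length cols)))

count≤-all : ∀ {n} row → All ((_≤ n) ∘ letter) row → count≤ n row ≡ length row
count≤-all row bnd = cong length (filter-all _ bnd)

count≤-zero : ∀ row → All ((0 <_) ∘ letter) row → count≤ 0 row ≡ 0
count≤-zero row pos = cong length (filter-none _ (All.map (λ 0<v v≤0 → <⇒≱ 0<v v≤0) pos))

count≤-mono : ∀ row {i i′} → i ≤ i′ → count≤ i row ≤ count≤ i′ row
count≤-mono []              _ = z≤n
count≤-mono ((c , v) ∷ row) {i} {i′} i≤i′ with v ≤? i
... | yes v≤i rewrite count≤-yes c row v≤i | count≤-yes c row (≤-trans v≤i i≤i′) = s≤s (count≤-mono row i≤i′)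
... | no v≰i rewrite count≤-no c row v≰i with v ≤? i′
...   | yes v≤i′ rewrite count≤-yes c row v≤i′ = m≤n⇒m≤1+n (count≤-mono row i≤i′)
...   | no v≰i′ rewrite count≤-no c row v≰i′ = count≤-mono row i≤i′

count≤-suc : ∀ row i → count≤ (suc i) row ≡ count≤ i row + count (suc i) (map letter row)
count≤-suc []              i = refl
count≤-suc ((c , v) ∷ row) i with suc i ≟ v
... | yes refl rewrite count≤-no {i} {suc i} c row 1+n≰n | count≤-yes {suc i} c row ≤-refl
                     | count-yes (suc i) (map letter row) =
  trans (cong suc (count≤-suc row i)) (sym (+-suc _ _))
... | no ≢v rewrite count-no (map letter row) ≢v with v ≤? i
...   | yes v≤i rewrite count≤-yes c row v≤i | count≤-yes c row (m≤n⇒m≤1+n v≤i) = cong suc (count≤-suc row i)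
...   | no v≰i rewrite count≤-no c row v≰i | count≤-no {suc i} c row (λ v≤ → ≢v (≤-antisym (≰⇒> v≰i) v≤)) = count≤-suc row i

row-≡ : ∀ row row′ → map column row ≡ map column row′ →
        (∀ {c v w} → (c , v) ∈ row → (c , w) ∈ row′ → v ≡ w) → row ≡ row′
row-≡ []            []             _  _ = refl
row-≡ ((c , v) ∷ row) ((c′ , w) ∷ row′) eq v≡w with refl , eq′ ← ∷ˡ-injective eq =
  cong₂ _∷_ (cong (c ,_) (v≡w (here refl) (here refl))) (row-≡ row row′ eq′ (λ p q → v≡w (there p) (there q)))

row-determined : ∀ {k d} n row row′ → Columns k d row → Columns k d row′ →
  Linked (_≤_ on letter) row → Linked (_≤_ on letter) row′ →
  All ((_≤ n) ∘ letter) row → All ((_≤ n) ∘ letter) row′ →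
  (∀ i → i ≤ n → count≤ i row ≡ count≤ i row′) → row ≡ row′
row-determined {k} n row row′ cols cols′ sorted sorted′ bnd bnd′ eq =
  row-≡ row row′ (trans cols (sym cols′)) λ {c} {v} {w} v∈ w∈ → ≤-antisym
    (from (letter≤⇔ w cols sorted v∈) (subst (λ m → c < k + m) (sym (eq w (All.lookup bnd′ w∈)))
      (to (letter≤⇔ w cols′ sorted′ w∈) ≤-refl)))
    (from (letter≤⇔ v cols′ sorted′ w∈) (subst (λ m → c < k + m) (eq v (All.lookup bnd v∈))
      (to (letter≤⇔ v cols sorted v∈) ≤-refl)))

-- Rebuilding a row from its levels

-- For monotone `f`, where the letters at most `i` end before column `f i`, this is the letter of a
-- column `c < f n`: the least `i` with `c < f i`.
rank : (ℕ → ℕ) → ℕ → ℕ → ℕ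
rank f zero    c = 0
rank f (suc n) c with f n ≤? c
... | yes _ = suc (rank f n c)
... | no  _ = rank f n c

rank-≤ : ∀ f n c → rank f n c ≤ n
rank-≤ f zero    c = z≤n
rank-≤ f (suc n) c with f n ≤? c
... | yes _ = s≤s (rank-≤ f n c)
... | no  _ = m≤n⇒m≤1+n (rank-≤ f n c)

rank-step : ∀ f n c → rank f n c ≤ rank f (suc n) c
rank-step f n c with f n ≤? c
... | yes _ = n≤1+n _
... | no _  = ≤-refl

rank-mono : ∀ f n {c c′} → c ≤ c′ → rank f n c ≤ rank f n c′
rank-mono f zero    _ = z≤n
rank-mono f (suc n) {c} {c′} c≤c′ with f n ≤? c | f n ≤? c′
... | yes _ | yes _ = s≤s (rank-mono f n c≤c′)
... | yes p | no ¬p = contradiction (≤-trans p c≤c′) ¬p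
... | no _  | yes _ = m≤n⇒m≤1+n (rank-mono f n c≤c′)
... | no _  | no _  = rank-mono f n c≤c′

Monotone : ℕ → (ℕ → ℕ) → Set
Monotone n f = ∀ {i j} → i ≤ j → j ≤ n → f i ≤ f j

rank-suc : ∀ f n c → f n ≤ c → rank f (suc n) c ≡ suc (rank f n c)
rank-suc f n c fn≤c with f n ≤? c
... | yes _ = refl
... | no ¬p = contradiction fn≤c ¬p

rank-full : ∀ {f c} n → Monotone n f → (∀ {i} → i < n → f i ≤ c) → rank f n c ≡ n
rank-full {f} {c} zero    _    _  = refl
rank-full {f} {c} (suc n) mono f≤ = trans (rank-suc f n c (f≤ (n<1+n n)))
  (cong suc (rank-full n (λ i≤j j≤ → mono i≤j (m≤n⇒m≤1+n j≤)) (λ i<n → f≤ (m≤n⇒m≤1+n i<n))))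

rank-above : ∀ {f n i c} → Monotone n f → i < n → f i ≤ c → i < rank f n c
rank-above {f} {suc n} {i} {c} mono i<n fi≤c with m≤n⇒m<n∨m≡n (s≤s⁻¹ i<n)
... | inj₁ i<n′ = ≤-trans (rank-above (λ i≤j j≤ → mono i≤j (m≤n⇒m≤1+n j≤)) i<n′ fi≤c) (rank-step f n c)
... | inj₂ refl = ≤-reflexive (sym (rank-full (suc n) mono
  (λ i<1+n → ≤-trans (mono (s≤s⁻¹ i<1+n) (n≤1+n n)) fi≤c)))

rank-below : ∀ {f n i c} → Monotone n f → i ≤ n → c < f i → rank f n c ≤ i
rank-below {f} {zero}  {i} _    _   _ = z≤n
rank-below {f} {suc n} {i} {c} mono i≤n c<fi with m≤n⇒m<n∨m≡n i≤n
... | inj₂ refl = rank-≤ f (suc n) c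
... | inj₁ i<1+n with f n ≤? c
...   | yes fn≤c = contradiction (≤-trans c<fi (≤-trans (mono (s≤s⁻¹ i<1+n) (n≤1+n n)) fn≤c)) (<-irrefl refl)
...   | no _     = rank-below (λ i≤j j≤ → mono i≤j (m≤n⇒m≤1+n j≤)) (s≤s⁻¹ i<1+n) c<fi

rank⇔ : ∀ {f n i c} → Monotone n f → i ≤ n → c < f n → rank f n c ≤ i ⇔ c < f i
rank⇔ {f} {n} {i} {c} mono i≤n c<fn = mk⇔ forward (rank-below mono i≤n)
  where
  forward : rank f n c ≤ i → c < f i
  forward r≤i with c <? f i | m≤n⇒m<n∨m≡n i≤n
  ... | yes c<fi | _         = c<fi
  ... | no _     | inj₂ refl = c<fn
  ... | no c≮fi  | inj₁ i<n  = contradiction r≤i (<⇒≱ (rank-above mono i<n (≮⇒≥ c≮fi)))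

-- the letters ≤ i fill the columns < f i
fillRow : ℕ → (ℕ → ℕ) → Row
fillRow n f = applyUpTo (λ x → f 0 + x , rank f n (f 0 + x)) (f n ∸ f 0)

fillRow-columns : ∀ n f → Columns (f 0) (f n ∸ f 0) (fillRow n f)
fillRow-columns n f = map-applyUpTo _ column (f n ∸ f 0)

fillRow-sorted : ∀ n f → Linked (_≤_ on letter) (fillRow n f)
fillRow-sorted n f = Linked.applyUpTo⁺₂ _ (f n ∸ f 0) λ x → rank-mono f n (+-monoʳ-≤ (f 0) (n≤1+n x))

∈-fillRow : ∀ {n f c v} → Monotone n f → (c , v) ∈ fillRow n f → f 0 ≤ c × c < f n × v ≡ rank f n c
∈-fillRow {n} {f} mono p with x , x< , refl ← ∈-applyUpTo⁻ _ p =
  m≤m+n (f 0) x , ≤-trans (+-monoʳ-< (f 0) x<) (≤-reflexive (m+[n∸m]≡n (mono z≤n ≤-refl))) , refl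

fillRow-positive : ∀ {n f} → Monotone n f → All ((0 <_) ∘ letter) (fillRow n f)
fillRow-positive {zero}  {f} mono rewrite n∸n≡0 (f 0) = []
fillRow-positive {suc n} mono = All.tabulate λ p →
  let f0≤ , _ , v≡ = ∈-fillRow mono p in subst (0 <_) (sym v≡) (rank-above mono z<s f0≤)

fillRow-bounded : ∀ {n f} → Monotone n f → All ((_≤ n) ∘ letter) (fillRow n f)
fillRow-bounded {n} {f} mono = All.tabulate λ {(c , _)} p →
  let _ , _ , v≡ = ∈-fillRow mono p in subst (_≤ n) (sym v≡) (rank-≤ f n c)

fillRow-count : ∀ {n f i} → Monotone n f → i ≤ n → f 0 + count≤ i (fillRow n f) ≡ f i
fillRow-count {n} {f} {i} mono i≤n = trans (cong (f 0 +_)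
  (count-interval (λ c → letter c ≤? i) (f 0) (f i) (fillRow n f) (fillRow-columns n f)
    (≤-trans (mono i≤n ≤-refl) (≤-reflexive (sym (m+[n∸m]≡n (mono z≤n ≤-refl))))) cells))
  (trans (cong (λ m → f 0 + (f i ∸ m)) (⊔-idem (f 0))) (m+[n∸m]≡n (mono z≤n i≤n)))
  where
  cells : ∀ {c} → c ∈ fillRow n f → letter c ≤ i ⇔ (f 0 ≤ column c × column c < f i)
  cells p with f0≤ , c< , refl ← ∈-fillRow mono p =
    mk⇔ (λ v≤i → f0≤ , to (rank⇔ mono i≤n c<) v≤i) (λ (_ , c<′) → from (rank⇔ mono i≤n c<) c<′)

-- Fillings and their levels

-- Rows beyond the end are empty, so that statements about rows can range over all indices.
at : List (List X) → ℕ → List X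
at []         _       = []
at (xs ∷ xss) zero    = xs
at (xs ∷ xss) (suc j) = at xss j

at-all : ∀ {P : List X → Set} {xss} → P [] → All P xss → ∀ j → P (at xss j)
at-all p []       j       = p
at-all p (q ∷ qs) zero    = q
at-all p (q ∷ qs) (suc j) = at-all p qs j

all-at : ∀ {P : List X → Set} xss → (∀ j → P (at xss j)) → All P xss
all-at []         p = []
all-at (xs ∷ xss) p = p 0 ∷ all-at xss (p ∘ suc)

at-applyUpTo : ∀ (f : ℕ → List X) {l j} → j < l → at (applyUpTo f l) j ≡ f j
at-applyUpTo f {suc l} {zero}  _         = refl
at-applyUpTo f {suc l} {suc j} (s≤s j<l) = at-applyUpTo (f ∘ suc) j<l

at-beyond : ∀ (xss : List (List X)) {j} → length xss ≤ j → at xss j ≡ []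
at-beyond []         _         = refl
at-beyond (xs ∷ xss) (s≤s l≤j) = at-beyond xss l≤j

at-≡ : ∀ (xss yss : List (List X)) → length xss ≡ length yss → (∀ j → at xss j ≡ at yss j) → xss ≡ yss
at-≡ []         []         _  _  = refl
at-≡ (xs ∷ xss) (ys ∷ yss) l≡ eq = cong₂ _∷_ (eq 0) (at-≡ xss yss (suc-injective l≡) (eq ∘ suc))

∈-concat-at⁺ : ∀ (xss : List (List X)) {x} j → x ∈ at xss j → x ∈ concat xss
∈-concat-at⁺ (xs ∷ xss) zero    x∈ = ∈-++⁺ˡ x∈
∈-concat-at⁺ (xs ∷ xss) (suc j) x∈ = ∈-++⁺ʳ xs (∈-concat-at⁺ xss j x∈)

∈-concat-at⁻ : ∀ (xss : List (List X)) {x} → x ∈ concat xss → ∃ λ j → x ∈ at xss j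
∈-concat-at⁻ (xs ∷ xss) x∈ with ∈-++⁻ xs x∈
... | inj₁ x∈xs = 0 , x∈xs
... | inj₂ x∈xss with j , x∈j ← ∈-concat-at⁻ xss x∈xss = suc j , x∈j

at-drop : ∀ k (xss : List (List X)) j → at (drop k xss) j ≡ at xss (k + j)
at-drop zero    xss        j = refl
at-drop (suc k) []         j = refl
at-drop (suc k) (xs ∷ xss) j = at-drop k xss j

map-at : ∀ {B : Set} (f : List X → B) xss {F l} → map f xss ≡ applyUpTo F l →
         length xss ≡ l × (∀ {j} → j < l → f (at xss j) ≡ F j)
map-at f []         {F} {zero}  eq = refl , λ ()
map-at f (xs ∷ xss) {F} {suc l} eq with eq₀ , eq′ ← ∷ˡ-injective eq
  with l≡ , ats ← map-at f xss eq′ = cong suc l≡ , λ { {zero} _ → eq₀ ; {suc j} (s≤s j<l) → ats j<l }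

at-map : ∀ {B : Set} (f : List X → B) xss {F} → (∀ {j} → j < length xss → f (at xss j) ≡ F j) →
         map f xss ≡ applyUpTo F (length xss)
at-map f []         eq = refl
at-map f (xs ∷ xss) eq = cong₂ _∷_ (eq z<s) (at-map f xss (eq ∘ s<s))

upColumns⁻ : ∀ {R : Rel ℕ 0ℓ} r → UpColumns R r → ∀ {j j′ c v w} → j < j′ →
             (c , v) ∈ at r j → (c , w) ∈ at r j′ → R v w
upColumns⁻ (row ∷ r) (u ∷ us) {zero}  {suc j′} _ p q =
  All.lookup (All.lookup (go r u j′) p) q refl
  where
  go : ∀ {P : Cell → Cell → Set} {row} r → All (λ upper → All (λ c → All (P c) upper) row) r →
       ∀ j → All (λ c → All (P c) (at r j)) row
  go r a j = at-all (All.universal (λ _ → []) _) a j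
upColumns⁻ (row ∷ r) (u ∷ us) {suc j} {suc j′} (s≤s j<j′) p q = upColumns⁻ r us j<j′ p q

upColumns⁺ : ∀ {R : Rel ℕ 0ℓ} r → (∀ {j j′ c v w} → j < j′ →
             (c , v) ∈ at r j → (c , w) ∈ at r j′ → R v w) → UpColumns R r
upColumns⁺ []        up = []
upColumns⁺ (row ∷ r) up =
  all-at r (λ j → All.tabulate λ p → All.tabulate λ { q refl → up {0} {suc j} z<s p q }) ∷
  upColumns⁺ r (λ j<j′ → up (s<s j<j′))

at-tabloid : ∀ r j →
  at (tabloid r) j ≡ map letter (filter (λ c → ¬? (c ∈? concat (drop (suc j) r))) (at r j))
at-tabloid []        j       = refl
at-tabloid (row ∷ r) zero    = refl
at-tabloid (row ∷ r) (suc j) = at-tabloid r j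

length-tabloid : ∀ r → length (tabloid r) ≡ length r
length-tabloid []        = refl
length-tabloid (row ∷ r) = cong suc (length-tabloid r)

count-map-filter : ∀ {P : Cell → Set} (P? : Decidable P) i row →
  count i (map letter (filter P? row)) ≡ length (filter (λ c → (i ≟ letter c) ×-dec P? c) row)
count-map-filter P? i []  = refl
count-map-filter {P} P? i (x ∷ row) = step (P? x) (i ≟ letter x)
  where
  Q? = λ c → (i ≟ letter c) ×-dec P? c
  step : Dec (P x) → Dec (i ≡ letter x) →
         count i (map letter (filter P? (x ∷ row))) ≡ length (filter Q? (x ∷ row))
  step (no ¬p) _ rewrite filter-reject P? {xs = row} ¬p | filter-reject Q? {x} {row} (¬p ∘ proj₂) =
    count-map-filter P? i row
  step (yes p) (yes refl) rewrite filter-accept P? {xs = row} p | filter-accept Q? {x} {row} (refl , p) =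
    trans (count-yes i (map letter (filter P? row))) (cong suc (count-map-filter P? i row))
  step (yes p) (no i≢) rewrite filter-accept P? {xs = row} p | filter-reject Q? {x} {row} (i≢ ∘ proj₁) =
    trans (count-no (map letter (filter P? row)) i≢) (count-map-filter P? i row)

-- A common frame for reverse plane partitions and tableaux: row `j` occupies the columns from
-- `lo j` up to, but excluding, `hi j`.
record Framed (lo hi : ℕ → ℕ) (n : ℕ) (r : Filling) : Set where
  field
    lo≤hi    : ∀ j → lo j ≤ hi j
    columns  : ∀ j → Columns (lo j) (hi j ∸ lo j) (at r j)
    sorted   : ∀ j → Linked (_≤_ on letter) (at r j)
    positive : ∀ j → All ((0 <_) ∘ letter) (at r j)
    bounded  : ∀ j → All ((_≤ n) ∘ letter) (at r j)

-- For a reverse plane partition these are the shapes ρ of the last passage recursion, for a tableau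
-- the entries of its Gelfand-Tsetlin pattern.
level : (ℕ → ℕ) → Filling → ℕ → ℕ → ℕ
level lo r i j = lo j + count≤ i (at r j)

module _ {lo hi n r} (F : Framed lo hi n r) where
  open Framed F

  lo+ : ∀ j → lo j + (hi j ∸ lo j) ≡ hi j
  lo+ j = m+[n∸m]≡n (lo≤hi j)

  letter≤⇔level : ∀ {j c v} i → (c , v) ∈ at r j → v ≤ i ⇔ c < level lo r i j
  letter≤⇔level {j} i p = letter≤⇔ i (columns j) (sorted j) p

  level≤hi : ∀ i j → level lo r i j ≤ hi j
  level≤hi i j = ≤-trans (count≤-bound i (columns j)) (≤-reflexive (lo+ j))

  level-zero : ∀ j → level lo r 0 j ≡ lo j
  level-zero j = trans (cong (lo j +_) (count≤-zero (at r j) (positive j))) (+-identityʳ _)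

  level-top : ∀ j → level lo r n j ≡ hi j
  level-top j = trans (cong (lo j +_)
    (trans (count≤-all (at r j) (bounded j)) (Columns-length {row = at r j} (columns j)))) (lo+ j)

  level-mono : ∀ {i i′} j → i ≤ i′ → level lo r i j ≤ level lo r i′ j
  level-mono j i≤i′ = +-monoʳ-≤ (lo j) (count≤-mono (at r j) i≤i′)

  cell-at : ∀ {j c} → lo j ≤ c → c < hi j → ∃ λ v → (c , v) ∈ at r j
  cell-at {j} lo≤c c<hi = column-occupied (columns j) lo≤c (≤-trans c<hi (≤-reflexive (sym (lo+ j))))

  cell-bounds : ∀ {j c v} → (c , v) ∈ at r j → lo j ≤ c × c < hi j
  cell-bounds {j} p with l , h ← column-bounds (columns j) p = l , ≤-trans h (≤-reflexive (lo+ j))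

  module _ (lo-desc : ∀ j → lo (suc j) ≤ lo j) (hi-desc : ∀ j → hi (suc j) ≤ hi j) where

    -- If the inequality failed, the column `level lo r i′ j` would hold a letter at most `i` in row
    -- `suc j`, hence a letter at most `i′` below it, although it is the first column past those
    -- letters. Weak columns use `i′ = i`, strict columns `i = suc i′`.
    upColumns⇒level : ∀ {R : Rel ℕ 0ℓ} {i i′} → UpColumns R r → (∀ {v w} → R v w → w ≤ i → v ≤ i′) →
                      ∀ j → level lo r i (suc j) ≤ level lo r i′ j
    upColumns⇒level {i = i} {i′} up imp j with level lo r i (suc j) ≤? level lo r i′ j
    ... | yes ≤l = ≤l
    ... | no ≰l = contradiction (to (letter≤⇔level i′ v∈)
      (imp (upColumns⁻ r up (n<1+n j) v∈ w∈) (from (letter≤⇔level i w∈) (≰⇒> ≰l)))) (<-irrefl refl)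
      where
      c = level lo r i′ j
      c<hi : c < hi (suc j)
      c<hi = ≤-trans (≰⇒> ≰l) (level≤hi i (suc j))
      v∈ = proj₂ (cell-at {j} {c} (m≤m+n (lo j) _) (≤-trans c<hi (hi-desc j)))
      w∈ = proj₂ (cell-at {suc j} {c} (≤-trans (lo-desc j) (m≤m+n (lo j) _)) c<hi)

  -- A cell with letter `w` lies within level `w` of its row, hence its column lies within level
  -- `f w` of any lower row and carries a letter at most `f w` there. `f` is `id` for weak and
  -- `pred` for strict columns.
  level⇒upColumns : ∀ {R : Rel ℕ 0ℓ} (f : ℕ → ℕ) → (∀ {v w} → 0 < w → v ≤ f w → R v w) →
                    (∀ {j j′} w → w ≤ n → j < j′ → level lo r w j′ ≤ level lo r (f w) j) → UpColumns R r
  level⇒upColumns f imp desc = upColumns⁺ r λ {j} {j′} {c} {v} {w} j<j′ p q →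
    imp (All.lookup (positive j′) q)
      (from (letter≤⇔level (f w) p) (≤-trans (to (letter≤⇔level w q) ≤-refl) (desc w (All.lookup (bounded j′) q) j<j′)))

antitone : ∀ {f : ℕ → ℕ} → (∀ j → f (suc j) ≤ f j) → ∀ {j j′} → j ≤ j′ → f j′ ≤ f j
antitone {f} desc {j} {j′} j≤j′ = go (≤⇒≤′ j≤j′)
  where
  go : ∀ {j′} → j ≤′ j′ → f j′ ≤ f j
  go ≤′-refl     = ≤-refl
  go (≤′-step p) = ≤-trans (desc _) (go p)

module _ {lo hi n r} (F : Framed lo hi n r)
         (lo-desc : ∀ j → lo (suc j) ≤ lo j) (hi-desc : ∀ j → hi (suc j) ≤ hi j)
         (up : UpColumns _≤_ r) where
  open Framed F

  private
    ρ = level lo r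

  ρ-desc : ∀ i j → ρ i (suc j) ≤ ρ i j
  ρ-desc i = upColumns⇒level F lo-desc hi-desc up ≤-trans

  -- The letters suc i surviving in row j sit in the columns from
  -- max (ρ i j) (ρ (suc i) (suc j)) up to ρ (suc i) j.
  level-growth : ∀ i j → ρ (suc i) j ≡ count (suc i) (at (tabloid r) j) + (ρ i j ⊔ ρ (suc i) (suc j))
  level-growth i j = trans (sym (m∸n+n≡m m≤)) (cong (_+ m) (sym count≡))
    where
    m = ρ i j ⊔ ρ (suc i) (suc j)
    m≤ : m ≤ ρ (suc i) j
    m≤ = ⊔-lub (level-mono F j (n≤1+n i)) (ρ-desc (suc i) j)
    above = concat (drop (suc j) r)
    above⇔ : ∀ {c} → (c , suc i) ∈ at r j → (c , suc i) ∈ above ⇔ c < ρ (suc i) (suc j)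
    above⇔ {c} p = mk⇔ forward backward
      where
      forward : (c , suc i) ∈ above → c < ρ (suc i) (suc j)
      forward q with j′ , q′ ← ∈-concat-at⁻ (drop (suc j) r) q
        rewrite at-drop (suc j) r j′ =
        ≤-trans (to (letter≤⇔level F (suc i) q′) ≤-refl)
          (antitone {ρ (suc i)} (ρ-desc (suc i)) (s≤s (m≤m+n j j′)))
      backward : c < ρ (suc i) (suc j) → (c , suc i) ∈ above
      backward c< with w , q ← cell-at F {suc j} {c}
          (≤-trans (lo-desc j) (proj₁ (cell-bounds F p))) (≤-trans c< (level≤hi F (suc i) (suc j)))
        -- The next cell up has a letter at least `suc i` by the column condition and at most
        -- `suc i` by its level.
        with refl ← ≤-antisym (upColumns⁻ r up (n<1+n j) p q) (from (letter≤⇔level F (suc i) q) c<) =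
        ∈-concat-at⁺ (drop (suc j) r) 0
          (subst ((c , suc i) ∈_) (sym (trans (at-drop (suc j) r 0) (cong (at r ∘ suc) (+-identityʳ j)))) q)
    cells : ∀ {c} → c ∈ at r j → (suc i ≡ letter c × ¬ c ∈ above) ⇔ (m ≤ column c × column c < ρ (suc i) j)
    cells {c , v} p = mk⇔ forward backward
      where
      forward : suc i ≡ v × ¬ (c , v) ∈ above → m ≤ c × c < ρ (suc i) j
      forward (refl , ∉above) =
        ⊔-lub (≮⇒≥ (λ c< → 1+n≰n (from (letter≤⇔level F i p) c<))) (≮⇒≥ (∉above ∘ from (above⇔ p))) ,
        to (letter≤⇔level F (suc i) p) ≤-refl
      backward : m ≤ c × c < ρ (suc i) j → suc i ≡ v × ¬ (c , v) ∈ above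
      backward (m≤c , c<) with refl ← ≤-antisym (from (letter≤⇔level F (suc i) p) c<)
        (≰⇒> (λ v≤i → <⇒≱ (to (letter≤⇔level F i p) v≤i) (≤-trans (m≤m⊔n _ _) m≤c))) =
        refl , λ q → <⇒≱ (to (above⇔ p) q) (≤-trans (m≤n⊔m _ _) m≤c)
    count≡ : count (suc i) (at (tabloid r) j) ≡ ρ (suc i) j ∸ m
    count≡ = begin
      count (suc i) (at (tabloid r) j)
        ≡⟨ cong (count (suc i)) (at-tabloid r j) ⟩
      count (suc i) (map letter (filter (λ c → ¬? (c ∈? above)) (at r j)))
        ≡⟨ count-map-filter (λ c → ¬? (c ∈? above)) (suc i) (at r j) ⟩
      length (filter (λ c → (suc i ≟ letter c) ×-dec ¬? (c ∈? above)) (at r j))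
        ≡⟨ count-interval _ m (ρ (suc i) j) (at r j) (columns j)
             (≤-trans (level≤hi F (suc i) j) (≤-reflexive (sym (lo+ F j)))) cells ⟩
      ρ (suc i) j ∸ (m ⊔ lo j)
        ≡⟨ cong (ρ (suc i) j ∸_) (m≥n⇒m⊔n≡m (≤-trans (m≤m+n (lo j) _) (m≤m⊔n (ρ i j) _))) ⟩
      ρ (suc i) j ∸ m ∎
      where open ≡-Reasoning

fill : ℕ → ℕ → (ℕ → ℕ → ℕ) → Filling
fill l n G = applyUpTo (λ j → fillRow n (λ i → G i j)) l

module _ {l n : ℕ} {G : ℕ → ℕ → ℕ} (mono : ∀ j → Monotone n (λ i → G i j))
         (empty : ∀ {j} → l ≤ j → G n j ≡ 0) where

  at-fill : ∀ j → at (fill l n G) j ≡ fillRow n (λ i → G i j)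
  at-fill j with j <? l
  ... | yes j<l = at-applyUpTo (λ j → fillRow n (λ i → G i j)) j<l
  ... | no j≮l = trans (at-beyond (fill l n G) (≤-trans (≤-reflexive (length-applyUpTo _ l)) (≮⇒≥ j≮l)))
    (sym (cong (applyUpTo _) (m≤n⇒m∸n≡0 {m = G n j} {G 0 j} (≤-trans (≤-reflexive (empty (≮⇒≥ j≮l))) z≤n))))

  fill-framed : Framed (G 0) (G n) n (fill l n G)
  fill-framed = record
    { lo≤hi    = λ j → mono j z≤n ≤-refl
    ; columns  = λ j → subst (Columns (G 0 j) (G n j ∸ G 0 j)) (sym (at-fill j)) (fillRow-columns n (λ i → G i j))
    ; sorted   = λ j → subst (Linked (_≤_ on letter)) (sym (at-fill j)) (fillRow-sorted n (λ i → G i j))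
    ; positive = λ j → subst (All _) (sym (at-fill j)) (fillRow-positive (mono j))
    ; bounded  = λ j → subst (All _) (sym (at-fill j)) (fillRow-bounded (mono j))
    }

  level-fill : ∀ {i} j → i ≤ n → level (G 0) (fill l n G) i j ≡ G i j
  level-fill {i} j i≤n = trans (cong (λ row → G 0 j + count≤ i row) (at-fill j)) (fillRow-count (mono j) i≤n)

level-determined : ∀ {lo hi n r r′} → Framed lo hi n r → Framed lo hi n r′ → length r ≡ length r′ →
                   (∀ i j → i ≤ n → level lo r i j ≡ level lo r′ i j) → r ≡ r′
level-determined {lo} {n = n} {r} {r′} F F′ l≡ eq = at-≡ r r′ l≡ λ j →
  row-determined n (at r j) (at r′ j) (columns F j) (columns F′ j) (sorted F j) (sorted F′ j) (bounded F j) (bounded F′ j)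
    (λ i i≤n → +-cancelˡ-≡ (lo j) _ _ (eq i j i≤n))
  where open Framed

-- Weights and ballot words

part-antitone : ∀ {μ} → Linked _≥_ μ → ∀ i → part μ (suc i) ≤ part μ i
part-antitone []          i       = z≤n
part-antitone [-]         i       = z≤n
part-antitone (m≥k ∷ _)   zero    = m≥k
part-antitone (_ ∷ desc)  (suc i) = part-antitone desc i

part-beyond : ∀ μ {i} → length μ ≤ i → part μ i ≡ 0
part-beyond []      _         = refl
part-beyond (m ∷ μ) (s≤s l≤i) = part-beyond μ l≤i

part-positive : ∀ {μ i} → All (0 <_) μ → i < length μ → 0 < part μ i
part-positive {i = zero}  (p ∷ _)  _         = p
part-positive {i = suc i} (_ ∷ ps) (s≤s i<l) = part-positive ps i<l

part-applyUpTo : ∀ f {l i} → i < l → part (applyUpTo f l) i ≡ f i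
part-applyUpTo f {suc l} {zero}  _         = refl
part-applyUpTo f {suc l} {suc i} (s≤s i<l) = part-applyUpTo (f ∘ suc) i<l

applyUpTo-part : ∀ μ → applyUpTo (part μ) (length μ) ≡ μ
applyUpTo-part []      = refl
applyUpTo-part (m ∷ μ) = cong (m ∷_) (applyUpTo-part μ)

largest-≤ : ∀ {n} w → All (_≤ n) w → largest w ≤ n
largest-≤ []      []       = z≤n
largest-≤ (x ∷ w) (p ∷ ps) = ⊔-lub p (largest-≤ w ps)

∈-≤-largest : ∀ {v w} → v ∈ w → v ≤ largest w
∈-≤-largest {w = w} = All.lookup (≤-largest w)

largest-∈ : ∀ w {n} → largest w ≡ suc n → suc n ∈ w
largest-∈ (x ∷ w) eq with ⊔-sel x (largest w)
... | inj₁ ≡x = here (trans (sym eq) ≡x)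
... | inj₂ ≡w = there (largest-∈ w (trans (sym ≡w) eq))

NoTrailingZero : List ℕ → Set
NoTrailingZero α = ∀ {m} → length α ≡ suc m → 0 < part α m

module _ (f : ℕ → ℕ) (w : List ℕ) (support : ∀ i → 0 < f i ⇔ suc i ∈ w) where

  -- Both `rppWeight` and `weight` have the form `applyUpTo f (largest w)`. Separating the bound on
  -- letters, the condition on α alone and the values of `f` lets an exponent be carried from a
  -- reverse plane partition to a tableau and back by comparing values.
  exponents⁻ : ∀ {α} → applyUpTo f (largest w) ≡ α →
    All (_≤ length α) w × NoTrailingZero α × (∀ {i} → i < length α → f i ≡ part α i)
  exponents⁻ refl = bounded-by-exponent f refl , positive , λ i<l →
    sym (part-applyUpTo f (≤-trans i<l (≤-reflexive (length-applyUpTo f (largest w)))))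
    where
    positive : NoTrailingZero (applyUpTo f (largest w))
    positive {m} eq rewrite length-applyUpTo f (largest w) | part-applyUpTo f {largest w} {m} (≤-reflexive (sym eq)) =
      from (support m) (largest-∈ w eq)

  exponents⁺ : ∀ {α} → All (_≤ length α) w → NoTrailingZero α → (∀ {i} → i < length α → f i ≡ part α i) →
    applyUpTo f (largest w) ≡ α
  exponents⁺ {α} bnd pos eq = trans (cong (applyUpTo f) (≤-antisym (largest-≤ w bnd) (reach (length α) refl)))
    (trans (applyUpTo-cong (length α) (λ i → eq)) (applyUpTo-part α))
    where
    reach : ∀ n → length α ≡ n → n ≤ largest w
    reach zero    _  = z≤n
    reach (suc m) l≡ = ∈-≤-largest (to (support m)
      (subst (0 <_) (sym (eq (≤-reflexive (sym l≡)))) (pos l≡)))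

count-++ : ∀ i w w′ → count i (w ++ w′) ≡ count i w + count i w′
count-++ i w w′ = trans (cong length (filter-++ (i ≟_) w w′)) (length-++ (filter (i ≟_) w))

count-support : ∀ w i → 0 < count i w ⇔ i ∈ w
count-support w i = mk⇔ (λ 0<c → forward w 0<c) (λ i∈ → ∈-length (∈-filter⁺ (i ≟_) i∈ refl))
  where
  forward : ∀ w → 0 < count i w → i ∈ w
  forward (x ∷ w) 0<c with i ≟ x
  ... | yes refl = here refl
  ... | no i≢x   = there (forward w (subst (0 <_) (count-no w i≢x) 0<c))

count-zero : ∀ {n} w {i} → All (_≤ n) w → n < i → count i w ≡ 0
count-zero w bnd n<i = cong length (filter-none (_ ≟_) (All.map (λ { x≤n refl → <⇒≱ n<i x≤n }) bnd))

part-weight : ∀ w j → part (weight w) j ≡ count (suc j) w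
part-weight w j with j <? largest w
... | yes j<l = part-applyUpTo (λ i → count (suc i) w) j<l
... | no j≮l  = trans (part-beyond (weight w) (≤-trans (≤-reflexive (length-applyUpTo _ (largest w))) (≮⇒≥ j≮l)))
  (sym (count-zero w (≤-largest w) (s≤s (≮⇒≥ j≮l))))

partitionWeight⇔ : ∀ w → IsPartition (weight w) ⇔ (∀ i → count (2 + i) w ≤ count (1 + i) w)
partitionWeight⇔ w = mk⇔
  (λ p i → subst₂ _≤_ (part-weight w (suc i)) (part-weight w i) (part-antitone (proj₁ p) i))
  (λ desc → Linked.applyUpTo⁺₂ _ (largest w) desc , All.applyUpTo⁺₁ _ (largest w) (positive desc))
  where
  positive : (∀ i → count (2 + i) w ≤ count (1 + i) w) → ∀ {i} → i < largest w → 0 < count (suc i) w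
  positive desc {i} i<l with largest w in eq
  -- The largest letter occurs, and by `desc` every smaller letter occurs at least as often.
  ... | suc m = ≤-trans (from (count-support w (suc m)) (largest-∈ w eq))
    (antitone {λ i → count (suc i) w} desc (s≤s⁻¹ i<l))

Ballot : ℕ → List ℕ → Set
Ballot i w = All (λ s → count (suc i) s ≤ count i s) (tails w)

yamanouchi⇔ballot : ∀ T → IsYamanouchi T ⇔ (∀ i → Ballot (suc i) (readingWord T))
yamanouchi⇔ballot T = mk⇔
  (λ yam i → All.map (λ {s} p → to (partitionWeight⇔ s) p i) yam)
  (λ bal → All.tabulate λ {s} s∈ → from (partitionWeight⇔ s) (λ i → All.lookup (bal i) s∈))

-- Read from the right, the letters suc i of a row come before its letters i.
ballot-row : ∀ i row w → Linked _≤_ row →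
  Ballot i (row ++ w) ⇔ (Ballot i w × count (suc i) row + count (suc i) w ≤ count i w)
ballot-row i row w sorted = mk⇔ (forward row (Linked.Linked⇒AllPairs ≤-trans sorted)) (λ (b , h) → backward row b h)
  where
  forward : ∀ row → AllPairs _≤_ row → Ballot i (row ++ w) →
            Ballot i w × count (suc i) row + count (suc i) w ≤ count i w
  forward []        _        b = b , All.head b
  forward (x ∷ row) (x≤ ∷ s) (p ∷ b) with suc i ≟ x
  ... | no ≢x rewrite count-no row ≢x = forward row s b
  ... | yes refl rewrite count-yes (suc i) row = proj₁ (forward row s b) , (begin
    suc (count (suc i) row + count (suc i) w)   ≡⟨ cong suc (sym (count-++ (suc i) row w)) ⟩
    suc (count (suc i) (row ++ w))              ≡⟨ sym (count-yes (suc i) (row ++ w)) ⟩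
    count (suc i) (suc i ∷ row ++ w)            ≤⟨ p ⟩
    count i (suc i ∷ row ++ w)                  ≡⟨ count-++ i (suc i ∷ row) w ⟩
    count i (suc i ∷ row) + count i w           ≡⟨ cong (_+ count i w) none ⟩
    count i w                                   ∎)
    where
    open ≤-Reasoning
    none : count i (suc i ∷ row) ≡ 0
    none = cong length (filter-none (i ≟_) {suc i ∷ row}
      ((λ ()) ∷ All.map (λ { {y} 1+i≤y refl → 1+n≰n 1+i≤y }) x≤))
  prefix : ∀ row → count (suc i) row + count (suc i) w ≤ count i w →
           count (suc i) (row ++ w) ≤ count i (row ++ w)
  prefix row h = ≤-trans (≤-reflexive (count-++ (suc i) row w))
    (≤-trans h (≤-trans (m≤n+m _ _) (≤-reflexive (sym (count-++ i row w)))))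
  backward : ∀ row → Ballot i w → count (suc i) row + count (suc i) w ≤ count i w → Ballot i (row ++ w)
  backward []        b h = b
  backward (x ∷ row) b h = prefix (x ∷ row) h ∷ backward row b
    (≤-trans (+-monoˡ-≤ _ (≤-trans (m≤n+m _ _) (≤-reflexive (sym (count-++ (suc i) [ x ] row))))) h)

tab : ∀ l → (ℕ → ℕ) → Vec ℕ l
tab zero    f = []
tab (suc l) f = f 0 ∷ tab l (f ∘ suc)

tab-cong : ∀ l {f h} → (∀ j → j < l → f j ≡ h j) → tab l f ≡ tab l h
tab-cong zero    eq = refl
tab-cong (suc l) eq = cong₂ _∷_ (eq 0 z<s) (tab-cong l (λ j j<l → eq (suc j) (s<s j<l)))

tab-injective : ∀ l {f h} → tab l f ≡ tab l h → ∀ {j} → j < l → f j ≡ h j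
tab-injective (suc l) eq {zero}  _         = cong Vec.head eq
tab-injective (suc l) eq {suc j} (s≤s j<l) = tab-injective l (cong Vec.tail eq) j<l

multiplicity : Tabloid → ℕ → ℕ → ℕ
multiplicity T i j = count i (at T j)

readingWord-∷ : ∀ row T → readingWord (row ∷ T) ≡ readingWord T ++ row
readingWord-∷ row T = trans (cong concat (unfold-reverse row T))
  (trans (sym (concat-++ (reverse T) [ row ])) (cong (readingWord T ++_) (++-identityʳ row)))

count-readingWord : ∀ i T → count i (readingWord T) ≡ Vec.sum (tab (length T) (multiplicity T i))
count-readingWord i []        = refl
count-readingWord i (row ∷ T) = trans (cong (count i) (readingWord-∷ row T))
  (trans (count-++ i (readingWord T) row) (trans (+-comm _ (count i row)) (cong (count i row +_) (count-readingWord i T))))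

private
  -- The word is scanned from the right, so w is read before T; x is its excess of i
  -- over suc i.
  ballot-from : ∀ i T w x → All (Linked _≤_) T → Ballot i w → count (suc i) w + x ≡ count i w →
    Ballot i (readingWord T ++ w) ⇔
    Dom x (tab (length T) (multiplicity T i)) (tab (length T) (multiplicity T (suc i)))
  ballot-from i []        w x _        b _  = mk⇔ (λ _ → tt) (λ _ → b)
  ballot-from i (row ∷ T) w x (s ∷ ss) b eq
    rewrite readingWord-∷ row T | ++-assoc (readingWord T) row w = mk⇔ forward backward
    where
    a = count (suc i) w
    head-≤ : ∀ {c} → c + a ≤ count i w → c ≤ x
    head-≤ {c} h = +-cancelˡ-≤ a _ _ (≤-trans (≤-reflexive (+-comm a c)) (≤-trans h (≤-reflexive (sym eq))))
    head-≥ : ∀ {c} → c ≤ x → c + a ≤ count i w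
    head-≥ {c} h = ≤-trans (+-monoˡ-≤ a h) (≤-reflexive (trans (+-comm x a) eq))
    rest : count (suc i) row ≤ x → Ballot i (row ++ w) →
      Ballot i (readingWord T ++ (row ++ w)) ⇔
      Dom (x ∸ count (suc i) row + count i row) (tab (length T) (multiplicity T i)) (tab (length T) (multiplicity T (suc i)))
    rest h b′ = ballot-from i T (row ++ w) _ ss b′ (begin
      count (suc i) (row ++ w) + (x ∸ k + m) ≡⟨ cong (_+ (x ∸ k + m)) (count-++ (suc i) row w) ⟩
      k + a + (x ∸ k + m)                    ≡⟨ lem k a (x ∸ k) m ⟩
      m + (a + (k + (x ∸ k)))                ≡⟨ cong (λ y → m + (a + y)) (m+[n∸m]≡n h) ⟩
      m + (a + x)                            ≡⟨ cong (m +_) eq ⟩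
      m + count i w                          ≡⟨ sym (count-++ i row w) ⟩
      count i (row ++ w)                     ∎)
      where
      open ≡-Reasoning
      k = count (suc i) row
      m = count i row
      lem : ∀ k a y m → k + a + (y + m) ≡ m + (a + (k + y))
      lem = solve-∀
    suffix : ∀ u {v} → Ballot i (u ++ v) → Ballot i v
    suffix []      b       = b
    suffix (_ ∷ u) (_ ∷ b) = suffix u b
    forward : Ballot i (readingWord T ++ (row ++ w)) → _
    forward p with b′ ← suffix (readingWord T) p with _ , h ← to (ballot-row i row w s) b′ =
      head-≤ h , to (rest (head-≤ h) b′) p
    backward : _ → Ballot i (readingWord T ++ (row ++ w))
    backward (h , d) = from (rest h (from (ballot-row i row w s) (b , head-≥ h))) d

ballot⇔Dom : ∀ i T → All (Linked _≤_) T →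
  Ballot i (readingWord T) ⇔ Dom 0 (tab (length T) (multiplicity T i)) (tab (length T) (multiplicity T (suc i)))
ballot⇔Dom i T s = subst
  (λ w → Ballot i w ⇔ Dom 0 (tab (length T) (multiplicity T i)) (tab (length T) (multiplicity T (suc i))))
  (++-identityʳ (readingWord T)) (ballot-from i T [] 0 s (z≤n ∷ []) refl)

columnsContaining-support : ∀ r i → 0 < length (columnsContaining i r) ⇔ i ∈ letters r
columnsContaining-support r i = mk⇔ forward backward
  where
  hits = map column (filter ((i ≟_) ∘ letter) (concat r))
  forward : 0 < length (columnsContaining i r) → i ∈ letters r
  forward 0<l with columnsContaining i r in eq
  ... | x ∷ _ with c , c∈ , _ ← ∈-map⁻ column (∈-deduplicate⁻ _≟_ hits (subst (x ∈_) (sym eq) (here refl)))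
    with c∈r , refl ← ∈-filter⁻ ((i ≟_) ∘ letter) {xs = concat r} c∈ = ∈-map⁺ letter c∈r
  backward : i ∈ letters r → 0 < length (columnsContaining i r)
  backward i∈ with c , c∈ , refl ← ∈-map⁻ letter i∈ =
    ∈-length (∈-deduplicate⁺ _≟_ {hits} (∈-map⁺ column (∈-filter⁺ ((i ≟_) ∘ letter) c∈ refl)))

-- Each column containing i is counted at its topmost i.
columnsContaining-sum : ∀ i r → All (Unique ∘ map column) r →
  length (columnsContaining i r) ≡ Vec.sum (tab (length r) (multiplicity (tabloid r) i))
columnsContaining-sum i []          _        = refl
columnsContaining-sum i (row ∷ r) (u ∷ us) = begin
  length (columnsContaining i (row ∷ r))
    ≡⟨ unique-length (DecUnique.deduplicate-! _≟_ _) unique-split members ⟩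
  length (map column new ++ columnsContaining i r)
    ≡⟨ length-++ (map column new) ⟩
  length (map column new) + length (columnsContaining i r)
    ≡⟨ cong₂ _+_ (trans (length-map column new) (sym (count-map-filter top? i row))) (columnsContaining-sum i r us) ⟩
  count i (map letter (filter top? row)) + Vec.sum (tab (length r) (multiplicity (tabloid r) i)) ∎
  where
  open ≡-Reasoning
  top? = λ c → ¬? (c ∈? concat r)
  new? = λ c → (i ≟ letter c) ×-dec top? c
  new = filter new? row
  hit? = (i ≟_) ∘ letter
  filter-unique : ∀ {P : Cell → Set} (P? : Decidable P) row → Unique (map column row) → Unique (map column (filter P? row))
  filter-unique P? []        _        = []
  filter-unique P? (x ∷ row) (v ∷ vs) with P? x
  ... | no _  = filter-unique P? row vs
  ... | yes _ = All.map⁺ (All.filter⁺ P? (All.map⁻ v)) ∷ filter-unique P? row vs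
  occurs : ∀ {x} → x ∈ columnsContaining i r → (x , i) ∈ concat r
  occurs p with (_ , _) , q , refl ← ∈-map⁻ column (∈-deduplicate⁻ _≟_ _ p)
    with q′ , refl ← ∈-filter⁻ hit? {xs = concat r} q = q′
  unique-split : Unique (map column new ++ columnsContaining i r)
  unique-split = Unique.++⁺ (filter-unique new? row u) (DecUnique.deduplicate-! _≟_ _) disjoint
    where
    disjoint : ∀ {x} → ¬ (x ∈ map column new × x ∈ columnsContaining i r)
    disjoint (p , q) with (_ , _) , p′ , refl ← ∈-map⁻ column p
      with _ , refl , ∉r ← ∈-filter⁻ new? {xs = row} p′ = ∉r (occurs q)
  members : ∀ x → x ∈ columnsContaining i (row ∷ r) ⇔ x ∈ map column new ++ columnsContaining i r
  members x = mk⇔ forward backward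
    where
    forward : x ∈ columnsContaining i (row ∷ r) → x ∈ map column new ++ columnsContaining i r
    forward p with (_ , _) , q , refl ← ∈-map⁻ column (∈-deduplicate⁻ _≟_ _ p)
      with q′ , refl ← ∈-filter⁻ hit? {xs = row ++ concat r} q with (x , i) ∈? concat r
    ... | yes ∈r = ∈-++⁺ʳ (map column new) (∈-deduplicate⁺ _≟_ (∈-map⁺ column (∈-filter⁺ hit? ∈r refl)))
    ... | no ∉r with ∈-++⁻ row q′
    ...   | inj₁ ∈row = ∈-++⁺ˡ (∈-map⁺ column (∈-filter⁺ new? ∈row (refl , ∉r)))
    ...   | inj₂ ∈r   = contradiction ∈r ∉r
    backward : x ∈ map column new ++ columnsContaining i r → x ∈ columnsContaining i (row ∷ r)
    backward p = ∈-deduplicate⁺ _≟_ (cell (∈-++⁻ (map column new) p))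
      where
      cell : x ∈ map column new ⊎ x ∈ columnsContaining i r → x ∈ map column (filter hit? (row ++ concat r))
      cell (inj₁ q) with (_ , _) , q′ , refl ← ∈-map⁻ column q
        with ∈row , refl , _ ← ∈-filter⁻ new? {xs = row} q′ = ∈-map⁺ column (∈-filter⁺ hit? (∈-++⁺ˡ ∈row) refl)
      cell (inj₂ q) = ∈-map⁺ column (∈-filter⁺ hit? (∈-++⁺ʳ row (occurs q)) refl)

-- Vectors of levels

look : Vec ℕ l → ℕ → ℕ
look []      _       = 0
look (x ∷ v) zero    = x
look (x ∷ v) (suc j) = look v j

look-tab : ∀ l {f j} → j < l → look (tab l f) j ≡ f j
look-tab (suc l) {j = zero}  _         = refl
look-tab (suc l) {j = suc j} (s≤s j<l) = look-tab l j<l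

look-beyond : ∀ (v : Vec ℕ l) {j} → l ≤ j → look v j ≡ 0
look-beyond []      _         = refl
look-beyond (x ∷ v) (s≤s l≤j) = look-beyond v l≤j

look-tab-supported : ∀ l {f} → (∀ {j} → l ≤ j → f j ≡ 0) → ∀ j → look (tab l f) j ≡ f j
look-tab-supported l {f} supp j with j <? l
... | yes j<l = look-tab l j<l
... | no j≮l  = trans (look-beyond (tab l f) (≮⇒≥ j≮l)) (sym (supp (≮⇒≥ j≮l)))

tab-look : ∀ (v : Vec ℕ l) → tab l (look v) ≡ v
tab-look []      = refl
tab-look (x ∷ v) = cong (x ∷_) (tab-look v)

bottom-look : ∀ (v : Vec ℕ l) → bottom v ≡ look v 0
bottom-look []      = refl
bottom-look (x ∷ v) = refl

look-grow : ∀ (a p : Vec ℕ l) j → look (grow a p) j ≡ look a j + (look p j ⊔ look (grow a p) (suc j))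
look-grow []       []       j       = refl
look-grow (a ∷ as) (p ∷ ps) zero    = cong (λ x → a + (p ⊔ x)) (bottom-look (grow as ps))
look-grow (a ∷ as) (p ∷ ps) (suc j) = look-grow as ps j

-- `grow` reads 0 above its last row, which is what `q l ≡ 0` matches.
grow-tab : ∀ l {a p q : ℕ → ℕ} → (∀ j → q j ≡ a j + (p j ⊔ q (suc j))) → q l ≡ 0 →
           grow (tab l a) (tab l p) ≡ tab l q
grow-tab zero    eq q≡0 = refl
grow-tab (suc l) {a} {p} {q} eq q≡0 rewrite grow-tab l {a ∘ suc} {p ∘ suc} {q ∘ suc} (eq ∘ suc) q≡0 =
  cong (_∷ tab l (q ∘ suc)) (trans (cong (λ x → a 0 + (p 0 ⊔ x)) (bottom-tab l {q} q≡0)) (sym (eq 0)))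
  where
  bottom-tab : ∀ l {q : ℕ → ℕ} → q (suc l) ≡ 0 → bottom (tab l (q ∘ suc)) ≡ q 1
  bottom-tab zero    q≡0 = sym q≡0
  bottom-tab (suc l) _   = refl

-- From the top row down, everything that is added to an entry of `a` is already known.
grow-injective : ∀ (a b p : Vec ℕ l) → grow a p ≡ grow b p → a ≡ b
grow-injective []       []       []       _  = refl
grow-injective (a ∷ as) (b ∷ bs) (p ∷ ps) eq with eq₀ , eq′ ← ∷-injective eq =
  cong₂ _∷_ (+-cancelʳ-≡ (p ⊔ bottom (grow as ps)) a b (trans eq₀ (cong (λ v → b + (p ⊔ bottom v)) (sym eq′))))
            (grow-injective as bs ps eq′)

-- The order is reversed because `Mat` and `Chain` begin with the largest letter.
down : ∀ m → (ℕ → ℕ) → Vec ℕ m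
down zero    f = []
down (suc m) f = f m ∷ down m f

-- undown v j is entry j counted from the end, and 0 beyond the vector.
undown : Vec ℕ n → ℕ → ℕ
undown []                  j = 0
undown {suc n} (x ∷ v) j with j ≟ n
... | yes _ = x
... | no  _ = undown v j

down-cong : ∀ m {f h} → (∀ {j} → j < m → f j ≡ h j) → down m f ≡ down m h
down-cong zero    eq = refl
down-cong (suc m) eq = cong₂ _∷_ (eq ≤-refl) (down-cong m (λ j<m → eq (m≤n⇒m≤1+n j<m)))

down-injective : ∀ m {f h} → down m f ≡ down m h → ∀ {j} → j < m → f j ≡ h j
down-injective (suc m) eq {j} j<1+m with m≤n⇒m<n∨m≡n (s≤s⁻¹ j<1+m)
... | inj₁ j<m  = down-injective m (cong Vec.tail eq) j<m
... | inj₂ refl = cong Vec.head eq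

undown-head : ∀ x (v : Vec ℕ n) → undown (x ∷ v) n ≡ x
undown-head {n} x v with n ≟ n
... | yes _  = refl
... | no n≢n = contradiction refl n≢n

undown-tail : ∀ x (v : Vec ℕ n) {j} → j ≢ n → undown (x ∷ v) j ≡ undown v j
undown-tail {n} x v {j} j≢n with j ≟ n
... | yes j≡n = contradiction j≡n j≢n
... | no _    = refl

undown-beyond : ∀ (v : Vec ℕ n) {j} → n ≤ j → undown v j ≡ 0
undown-beyond []      _   = refl
undown-beyond (x ∷ v) n<j = trans (undown-tail x v (λ { refl → 1+n≰n n<j })) (undown-beyond v (<⇒≤ n<j))

down-undown : ∀ (v : Vec ℕ n) → down n (undown v) ≡ v
down-undown []              = refl
down-undown {suc n} (x ∷ v) = cong₂ _∷_ (undown-head x v)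
  (trans (down-cong n (λ j<n → undown-tail x v (<⇒≢ j<n))) (down-undown v))

interlacing⇔ : ∀ m f h → Interlacing (down (suc m) f) (down m h) ⇔
               (∀ {j} → j < m → f (suc j) ≤ h j × h j ≤ f j)
interlacing⇔ zero    f h = mk⇔ (λ _ ()) (λ _ → tt)
interlacing⇔ (suc m) f h = mk⇔
  (λ (p , q , rest) {j} j<1+m → case-last p q rest (m≤n⇒m<n∨m≡n (s≤s⁻¹ j<1+m)))
  (λ all → proj₁ (all ≤-refl) , proj₂ (all ≤-refl) , from (interlacing⇔ m f h) (λ j<m → all (m≤n⇒m≤1+n j<m)))
  where
  case-last : f (suc m) ≤ h m → h m ≤ f m → Interlacing (down (suc m) f) (down m h) →
              ∀ {j} → j < m ⊎ j ≡ m → f (suc j) ≤ h j × h j ≤ f j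
  case-last p q rest (inj₁ j<m)  = to (interlacing⇔ m f h) rest j<m
  case-last p q rest (inj₂ refl) = p , q

sum-down-+ : ∀ m (f h : ℕ → ℕ) → Vec.sum (down m (λ j → f j + h j)) ≡ Vec.sum (down m f) + Vec.sum (down m h)
sum-down-+ zero    f h = refl
sum-down-+ (suc m) f h rewrite sum-down-+ m f h = lem (f m) (h m) _ _
  where
  lem : ∀ a b c d → a + b + (c + d) ≡ a + c + (b + d)
  lem = solve-∀

sum-down-tab : ∀ m f → Vec.sum (tab m f) ≡ Vec.sum (down m f)
sum-down-tab zero    f = refl
sum-down-tab (suc m) f = trans (cong (f 0 +_) (sum-down-tab m (f ∘ suc))) (shift m f)
  where
  shift : ∀ m f → f 0 + Vec.sum (down m (f ∘ suc)) ≡ Vec.sum (down (suc m) f)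
  shift zero    f = refl
  shift (suc m) f = trans (lem (f 0) (f (suc m)) _) (cong (f (suc m) +_) (shift m f))
    where
    lem : ∀ a b c → a + (b + c) ≡ b + (a + c)
    lem = solve-∀

sum-down-extend : ∀ {a b} f → a ≤′ b → (∀ {j} → a ≤ j → f j ≡ 0) → Vec.sum (down b f) ≡ Vec.sum (down a f)
sum-down-extend f ≤′-refl               _    = refl
sum-down-extend f (≤′-step {n = b} a≤b) supp =
  trans (cong (_+ Vec.sum (down b f)) (supp (≤′⇒≤ a≤b))) (sum-down-extend f a≤b supp)

sum-down-supported : ∀ {a b} f → (∀ {j} → a ≤ j → f j ≡ 0) → (∀ {j} → b ≤ j → f j ≡ 0) →
                     Vec.sum (down a f) ≡ Vec.sum (down b f)
sum-down-supported {a} {b} f supp-a supp-b with ≤-total a b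
... | inj₁ a≤b = sym (sum-down-extend f (≤⇒≤′ a≤b) supp-a)
... | inj₂ b≤a = sum-down-extend f (≤⇒≤′ b≤a) supp-b

-- A vector of n functions holds those with the indices n, …, 1; the base has index 0,
-- and above n the last function is repeated.
peak : (ℕ → ℕ) → Vec (ℕ → ℕ) n → ℕ → ℕ
peak b []      = b
peak b (f ∷ _) = f

stack : (ℕ → ℕ) → Vec (ℕ → ℕ) n → ℕ → ℕ → ℕ
stack b []               i = b
stack {suc n} b (f ∷ fs) i with i ≤? n
... | yes _ = stack b fs i
... | no  _ = f

stack-below : ∀ b f (fs : Vec (ℕ → ℕ) n) {i} → i ≤ n → stack b (f ∷ fs) i ≡ stack b fs i
stack-below {n} b f fs {i} i≤n with i ≤? n
... | yes _  = refl
... | no i≰n = contradiction i≤n i≰n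

stack-peak : ∀ b (fs : Vec (ℕ → ℕ) n) → stack b fs n ≡ peak b fs
stack-peak         b []       = refl
stack-peak {suc n} b (f ∷ fs) with suc n ≤? n
... | yes n<n = contradiction n<n 1+n≰n
... | no _    = refl

stack-base : ∀ b (fs : Vec (ℕ → ℕ) n) → stack b fs 0 ≡ b
stack-base b []       = refl
stack-base b (f ∷ fs) = trans (stack-below b f fs z≤n) (stack-base b fs)

module _ (S : (ℕ → ℕ) → (ℕ → ℕ) → Set) where

  Steps : (ℕ → ℕ) → Vec (ℕ → ℕ) n → Set
  Steps b []       = ⊤
  Steps b (f ∷ fs) = S (peak b fs) f × Steps b fs

  stack-step : ∀ b (fs : Vec (ℕ → ℕ) n) → Steps b fs → ∀ {i} → i < n → S (stack b fs i) (stack b fs (suc i))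
  stack-step {suc n} b (f ∷ fs) (s , ss) {i} (s≤s i≤n) with m≤n⇒m<n∨m≡n i≤n
  ... | inj₁ i<n rewrite stack-below b f fs i≤n | stack-below b f fs i<n = stack-step b fs ss i<n
  ... | inj₂ refl = subst₂ S (sym (trans (stack-below b f fs i≤n) (stack-peak b fs))) (sym (stack-peak b (f ∷ fs))) s

steps⇒monotone : ∀ {f : ℕ → ℕ} n → (∀ {i} → i < n → f i ≤ f (suc i)) → Monotone n f
steps⇒monotone {f} n step i≤j j≤n = go (≤⇒≤′ i≤j) j≤n
  where
  go : ∀ {i j} → i ≤′ j → j ≤ n → f i ≤ f j
  go ≤′-refl     _   = ≤-refl
  go (≤′-step p) j≤n = ≤-trans (go p (<⇒≤ j≤n)) (step j≤n)

mat : ∀ n l → (ℕ → ℕ → ℕ) → Mat n l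
mat zero    l N = []
mat (suc n) l N = tab l (N (suc n)) ∷ mat n l N

ladder : ∀ n → (ℕ → ℕ → ℕ) → Chain n
ladder zero    G = tt
ladder (suc n) G = down (suc n) (G (suc n)) , ladder n G

top-ladder : ∀ n G → top (ladder n G) ≡ down n (G n)
top-ladder zero    G = refl
top-ladder (suc n) G = refl

mat-injective : ∀ {m N N′} n l → m ≤ n → mat n l N ≡ mat n l N′ → mat m l N ≡ mat m l N′
mat-injective {m} zero    l z≤n eq = refl
mat-injective {m} (suc n) l m≤1+n eq with m≤n⇒m<n∨m≡n m≤1+n
... | inj₂ refl  = eq
... | inj₁ m<1+n = mat-injective n l (s≤s⁻¹ m<1+n) (cong Vec.tail eq)

ladder-injective : ∀ {m G H} n → m ≤ n → ladder n G ≡ ladder n H → down m (G m) ≡ down m (H m)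
ladder-injective zero    z≤n eq = refl
ladder-injective (suc n) m≤1+n eq with m≤n⇒m<n∨m≡n m≤1+n
... | inj₂ refl  = cong proj₁ eq
... | inj₁ m<1+n = ladder-injective n (s≤s⁻¹ m<1+n) (cong proj₂ eq)

-- The content of the tableau that the pattern encodes, read off from the differences of consecutive
-- row sums.
Content : (ℕ → ℕ) → Chain n → Set
Content {zero}  a _       = ⊤
Content {suc n} a (μ , C) = Vec.sum μ ≡ a n + Vec.sum (top C) × Content a C

content-unique : ∀ {a b} (C : Chain n) → Content a C → Content b C → ∀ {i} → i < n → a i ≡ b i
content-unique {suc n} (μ , C) (p , ps) (q , qs) {i} (s≤s i≤n) with m≤n⇒m<n∨m≡n i≤n
... | inj₁ i<n  = content-unique C ps qs i<n
... | inj₂ refl = +-cancelʳ-≡ (Vec.sum (top C)) _ _ (trans (sym p) q)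

content-shapes : ∀ n l N → Content (λ i → Vec.sum (tab l (N (suc i)))) (shapes (mat n l N))
content-shapes zero    l N = tt
content-shapes (suc n) l N =
  trans (sum-insert (tab l (N (suc n))) (rsk (mat n l N)))
    (cong (λ v → Vec.sum (tab l (N (suc n))) + Vec.sum v) (sym (top-shapes (mat n l N)))) ,
  content-shapes n l N

framed : ∀ {ν λ′ n r} → λ′ ⊆ ν → IsFilling (skew ν λ′) r → RowsWeaklyIncreasing r → All (_≤ n) (letters r) →
         Framed (part λ′) (part ν) n r
framed {ν} {λ′} {n} {r} λ⊆ν (shape , pos) rows bnd = record
  { lo≤hi    = λ⊆ν
  ; columns  = cols
  ; sorted   = at-all [] rows
  ; positive = at-all [] pos
  ; bounded  = at-all [] (All.concat⁻ {xss = r} (All.map⁻ bnd))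
  }
  where
  cols : ∀ j → Columns (part λ′ j) (part ν j ∸ part λ′ j) (at r j)
  cols j with l≡ , ats ← map-at (map column) r shape with j <? length ν
  ... | yes j<l = ats j<l
  ... | no j≮l rewrite at-beyond r (≤-trans (≤-reflexive l≡) (≮⇒≥ j≮l)) | part-beyond ν (≮⇒≥ j≮l) | 0∸n≡0 (part λ′ j) = refl

filling-length : ∀ {ν λ′ r} → IsFilling (skew ν λ′) r → length r ≡ length ν
filling-length {r = r} (shape , _) = proj₁ (map-at (map column) r shape)

isFilling⁺ : ∀ {ν λ′ n r} → Framed (part λ′) (part ν) n r → length r ≡ length ν →
             IsFilling (skew ν λ′) r × RowsWeaklyIncreasing r
isFilling⁺ {ν} {λ′} {n} {r} F l≡ =
  (trans (at-map (map column) r {F = λ i → applyUpTo (part λ′ i +_) (part ν i ∸ part λ′ i)} (λ {j} _ → columns j))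
    (cong (applyUpTo _) l≡) , all-at r positive) , all-at r sorted
  where open Framed F

letters-bounded : ∀ {lo hi n r} → Framed lo hi n r → All (_≤ n) (letters r)
letters-bounded {r = r} F = All.map⁺ (All.concat⁺ (all-at r (Framed.bounded F)))

framed-≡ : ∀ {lo hi lo′ hi′ n r} → (∀ j → lo j ≡ lo′ j) → (∀ j → hi j ≡ hi′ j) →
           Framed lo hi n r → Framed lo′ hi′ n r
framed-≡ {r = r} lo≡ hi≡ F = record
  { lo≤hi    = λ j → subst₂ _≤_ (lo≡ j) (hi≡ j) (lo≤hi j)
  ; columns  = λ j → subst₂ (λ a b → Columns a (b ∸ a) (at r j)) (lo≡ j) (hi≡ j) (columns j)
  ; sorted   = sorted
  ; positive = positive
  ; bounded  = bounded
  }
  where open Framed F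

-- Reverse plane partitions as matrices, tableaux as patterns

record Skew (l : ℕ) (ν λ′ : List ℕ) : Set where
  field
    rows    : l ≡ length ν
    inside  : λ′ ⊆ ν
    ν-desc  : ∀ j → part ν (suc j) ≤ part ν j
    λ-desc  : ∀ j → part λ′ (suc j) ≤ part λ′ j

  ν-beyond : ∀ {j} → l ≤ j → part ν j ≡ 0
  ν-beyond l≤j = part-beyond ν (≤-trans (≤-reflexive (sym rows)) l≤j)

  λ-beyond : ∀ {j} → l ≤ j → part λ′ j ≡ 0
  λ-beyond {j} l≤j = n≤0⇒n≡0 (≤-trans (inside j) (≤-reflexive (ν-beyond l≤j)))

lookups : Mat n l → Vec ℕ l → Vec (ℕ → ℕ) n
lookups []      p = []
lookups (v ∷ A) p = look (act (v ∷ A) p) ∷ lookups A p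

peak-lookups : ∀ (A : Mat n l) p → peak (look p) (lookups A p) ≡ look (act A p)
peak-lookups []      p = refl
peak-lookups (v ∷ A) p = refl

lookups-steps : ∀ (A : Mat n l) p → Steps (λ f h → ∀ j → f j ≤ h j) (look p) (lookups A p)
lookups-steps []      p = tt
lookups-steps (v ∷ A) p = step , lookups-steps A p
  where
  step : ∀ j → peak (look p) (lookups A p) j ≤ look (grow v (act A p)) j
  step j rewrite peak-lookups A p | look-grow v (act A p) j = ≤-trans (m≤m⊔n _ _) (m≤n+m _ _)

lookups-desc : ∀ (A : Mat n l) p → (∀ j → look p (suc j) ≤ look p j) →
               ∀ i j → stack (look p) (lookups A p) i (suc j) ≤ stack (look p) (lookups A p) i j
lookups-desc []              p desc i j = desc j
lookups-desc {suc n} (v ∷ A) p desc i j with i ≤? n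
... | yes _ = lookups-desc A p desc i j
... | no _ rewrite look-grow v (act A p) j = ≤-trans (m≤n⊔m (look (act A p) j) _) (m≤n+m _ _)

module RPP {l ν λ′} (S : Skew l ν λ′) where
  open Skew S

  private
    start = tab l (part λ′)

  record Bounded (n : ℕ) (r : Filling) : Set where
    constructor bounded-rpp
    field
      isRPP : IsRPP ν λ′ r
      ≤n    : All (_≤ n) (letters r)

    frame : Framed (part λ′) (part ν) n r
    frame = framed {ν} {λ′} inside (proj₁ isRPP) (proj₁ (proj₂ isRPP)) ≤n

    length≡ : length r ≡ l
    length≡ = trans (filling-length {ν} {λ′} (proj₁ isRPP)) (sym rows)

    ρ : ℕ → ℕ → ℕ
    ρ = level (part λ′) r

    ρ-beyond : ∀ i {j} → l ≤ j → ρ i j ≡ 0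
    ρ-beyond i {j} l≤j = n≤0⇒n≡0 (≤-trans (level≤hi frame i j) (≤-reflexive (ν-beyond l≤j)))

    act-mat : ∀ m → act (mat m l (multiplicity (tabloid r))) start ≡ tab l (ρ m)
    act-mat zero    = tab-cong l (λ j _ → sym (level-zero frame j))
    act-mat (suc m) rewrite act-mat m =
      grow-tab l (level-growth frame λ-desc ν-desc (proj₂ (proj₂ isRPP)) m) (ρ-beyond (suc m) ≤-refl)

    act-mat-top : act (mat n l (multiplicity (tabloid r))) start ≡ tab l (part ν)
    act-mat-top = trans (act-mat n) (tab-cong l (λ j _ → level-top frame j))

    sum-multiplicity : ∀ i → length (columnsContaining i r) ≡ Vec.sum (tab l (multiplicity (tabloid r) i))
    sum-multiplicity i = subst (λ m → length (columnsContaining i r) ≡ Vec.sum (tab m (multiplicity (tabloid r) i))) length≡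
      (columnsContaining-sum i r (all-at r (λ j → Columns-unique {row = at r j} (Framed.columns frame j))))

    isTabloid : IsTabloid (tabloid r)
    isTabloid =
      all-at (tabloid r) (λ j → subst (All (0 <_)) (sym (at-tabloid r j))
        (All.map⁺ (All.filter⁺ _ (Framed.positive frame j)))) ,
      all-at (tabloid r) (λ j → subst (Linked _≤_) (sym (at-tabloid r j))
        (Linked.map⁺ (Linked.filter⁺ _ ≤-trans (Framed.sorted frame j))))

  open Bounded

  mat-tabloid-injective : ∀ {n r r′} → Bounded n r → Bounded n r′ →
    mat n l (multiplicity (tabloid r)) ≡ mat n l (multiplicity (tabloid r′)) → r ≡ r′
  mat-tabloid-injective {n} {r} {r′} B B′ eq =
    level-determined (frame B) (frame B′) (trans (length≡ B) (sym (length≡ B′))) levels≡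
    where
    levels≡ : ∀ i j → i ≤ n → ρ B i j ≡ ρ B′ i j
    levels≡ i j i≤n with j <? l
    ... | no j≮l  = trans (ρ-beyond B i (≮⇒≥ j≮l)) (sym (ρ-beyond B′ i (≮⇒≥ j≮l)))
    ... | yes j<l = tab-injective l (trans (sym (act-mat B i))
      (trans (cong (λ A → act A start) (mat-injective n l i≤n eq)) (act-mat B′ i))) j<l

  -- The results of `act` on the tails of `A` are taken as levels and filled in. That the tabloid of
  -- this filling returns `A` follows row by row from `grow-injective`, since both matrices produce
  -- the same levels.
  inflate : ∀ {n} (A : Mat n l) → act A start ≡ tab l (part ν) →
            ∃ λ r → Bounded n r × mat n l (multiplicity (tabloid r)) ≡ A
  inflate {n} A act≡ = r , B , recover A (λ i≤n → tab-cong l (λ j _ → ρ≡G i≤n j))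
    where
    G = stack (look start) (lookups A start)
    mono : ∀ j → Monotone n (λ i → G i j)
    mono j = steps⇒monotone n (λ i<n → stack-step _ (look start) (lookups A start) (lookups-steps A start) i<n j)
    look-start : ∀ j → look start j ≡ part λ′ j
    look-start = look-tab-supported l λ-beyond
    G0 : ∀ j → G 0 j ≡ part λ′ j
    G0 j = trans (cong (λ f → f j) (stack-base (look start) (lookups A start))) (look-start j)
    Gn : ∀ j → G n j ≡ part ν j
    Gn j = trans (cong (λ f → f j) (trans (stack-peak (look start) (lookups A start)) (peak-lookups A start)))
      (trans (cong (λ v → look v j) act≡) (look-tab-supported l ν-beyond j))
    empty : ∀ {j} → l ≤ j → G n j ≡ 0
    empty {j} l≤j = trans (Gn j) (ν-beyond l≤j)
    r = fill l n G
    F : Framed (part λ′) (part ν) n r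
    F = framed-≡ G0 Gn (fill-framed mono empty)
    ρ≡G : ∀ {i} → i ≤ n → ∀ j → level (part λ′) r i j ≡ G i j
    ρ≡G {i} i≤n j = trans (cong (_+ count≤ i (at r j)) (sym (G0 j))) (level-fill mono empty j i≤n)
    G-desc : ∀ i j → G i (suc j) ≤ G i j
    G-desc = lookups-desc A start (λ j → subst₂ _≤_ (sym (look-start (suc j))) (sym (look-start j)) (λ-desc j))
    up : UpColumns _≤_ r
    up = level⇒upColumns F id (λ _ v≤w → v≤w) λ {j} {j′} w w≤n j<j′ →
      subst₂ _≤_ (sym (ρ≡G w≤n j′)) (sym (ρ≡G w≤n j)) (antitone {G w} (G-desc w) (<⇒≤ j<j′))
    isFilling×rows = isFilling⁺ {ν} {λ′} F (trans (length-applyUpTo _ l) rows)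
    B : Bounded n r
    B = bounded-rpp (proj₁ isFilling×rows , proj₂ isFilling×rows , up) (letters-bounded F)
    recover : ∀ {m} (A : Mat m l) →
      (∀ {i} → i ≤ m → tab l (ρ B i) ≡ tab l (stack (look start) (lookups A start) i)) →
      mat m l (multiplicity (tabloid r)) ≡ A
    recover []              _  = refl
    recover {suc m} (v ∷ A) eq = cong₂ _∷_ (grow-injective _ v (act A start) (begin
      grow (tab l (multiplicity (tabloid r) (suc m))) (act A start)
        ≡⟨ cong (λ A → grow (tab l (multiplicity (tabloid r) (suc m))) (act A start)) (sym ih) ⟩
      act (mat (suc m) l (multiplicity (tabloid r))) start
        ≡⟨ act-mat B (suc m) ⟩
      tab l (ρ B (suc m))
        ≡⟨ eq ≤-refl ⟩
      tab l (stack (look start) (lookups (v ∷ A) start) (suc m))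
        ≡⟨ cong (tab l) (stack-peak (look start) (lookups (v ∷ A) start)) ⟩
      tab l (look (act (v ∷ A) start))
        ≡⟨ tab-look (act (v ∷ A) start) ⟩
      act (v ∷ A) start ∎)) ih
      where
      open ≡-Reasoning
      ih : mat m l (multiplicity (tabloid r)) ≡ A
      ih = recover A (λ i≤m → trans (eq (m≤n⇒m≤1+n i≤m))
        (cong (tab l) (stack-below (look start) (look (act (v ∷ A) start)) (lookups A start) i≤m)))

-- Yamanouchi tabloids as Yamanouchi matrices

Dom-zero : ∀ l x a {f} → (∀ j → f j ≡ 0) → Dom x (tab l a) (tab l f)
Dom-zero zero    x a eq = tt
Dom-zero (suc l) x a {f} eq rewrite eq 0 = z≤n , Dom-zero l (x + a 0) (a ∘ suc) (eq ∘ suc)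

≤-cases : ∀ {P : ℕ → Set} {n} → (∀ i → i < n → P i) → P n → ∀ i → i ≤ n → P i
≤-cases below at-n i i≤n with m≤n⇒m<n∨m≡n i≤n
... | inj₁ i<n  = below i i<n
... | inj₂ refl = at-n

yam-mat⁻ : ∀ n l N → Yam (mat n l N) → ∀ i → 2 + i ≤ n → Dom 0 (tab l (N (1 + i))) (tab l (N (2 + i)))
yam-mat⁻ (suc zero)    l N _         i (s≤s ())
yam-mat⁻ (suc (suc n)) l N (d , yam) i (s≤s (s≤s i≤n)) =
  ≤-cases {P = λ i → Dom 0 (tab l (N (1 + i))) (tab l (N (2 + i)))}
    (λ i i<n → yam-mat⁻ (suc n) l N yam i (s≤s i<n)) d i i≤n

yam-mat⁺ : ∀ n l N → (∀ i → 2 + i ≤ n → Dom 0 (tab l (N (1 + i))) (tab l (N (2 + i)))) → Yam (mat n l N)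
yam-mat⁺ zero          l N dom = tt
yam-mat⁺ (suc zero)    l N dom = tt
yam-mat⁺ (suc (suc n)) l N dom = dom n ≤-refl , yam-mat⁺ (suc n) l N (λ i i≤ → dom i (m≤n⇒m≤1+n i≤))

yamanouchi⇔yam : ∀ {n} T → All (Linked _≤_) T → All (_≤ n) (readingWord T) →
                 IsYamanouchi T ⇔ Yam (mat n (length T) (multiplicity T))
yamanouchi⇔yam {n} T s bnd = mk⇔
  (λ yam → yam-mat⁺ n (length T) (multiplicity T) λ i _ →
    to (ballot⇔Dom (1 + i) T s) (to (yamanouchi⇔ballot T) yam i))
  (λ yam → from (yamanouchi⇔ballot T) λ i → from (ballot⇔Dom (1 + i) T s) (dom yam i))
  where
  dom : Yam (mat n (length T) (multiplicity T)) → ∀ i →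
        Dom 0 (tab (length T) (multiplicity T (1 + i))) (tab (length T) (multiplicity T (2 + i)))
  dom yam i with 2 + i ≤? n
  ... | yes ≤n = yam-mat⁻ n (length T) (multiplicity T) yam i ≤n
  -- The letter `2 + i` exceeds the bound and does not occur, so there is nothing to pair.
  ... | no ≰n  = Dom-zero (length T) 0 _ λ j → count-zero (at T j)
    (All.tabulate (λ x∈ → All.lookup bnd (concat⊆readingWord T (∈-concat-at⁺ T j x∈)))) (≰⇒> ≰n)

weights-mat : ∀ n T → weights (mat n (length T) (multiplicity T)) ≡ down n (part (weight (readingWord T)))
weights-mat zero    T = refl
weights-mat (suc n) T = cong₂ _∷_
  (sym (trans (part-weight (readingWord T) n) (count-readingWord (suc n) T))) (weights-mat n T)

-- Semistandard tableaux as Gelfand-Tsetlin patterns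

undowns : Chain n → Vec (ℕ → ℕ) n
undowns {zero}  _       = []
undowns {suc n} (μ , C) = undown μ ∷ undowns C

zeros : ℕ → ℕ
zeros _ = 0

peak-undowns : ∀ (C : Chain n) → peak zeros (undowns C) ≡ undown (top C)
peak-undowns {zero}  C = refl
peak-undowns {suc n} C = refl

interlacing-undown : ∀ (μ : Vec ℕ (suc n)) (κ : Vec ℕ n) → Interlacing μ κ →
                     ∀ j → undown μ (suc j) ≤ undown κ j × undown κ j ≤ undown μ j
interlacing-undown {n} μ κ int j with j <? n
... | yes j<n = to (interlacing⇔ n (undown μ) (undown κ))
  (subst₂ Interlacing (sym (down-undown μ)) (sym (down-undown κ)) int) j<n
... | no j≮n rewrite undown-beyond μ {suc j} (s≤s (≮⇒≥ j≮n)) | undown-beyond κ {j} (≮⇒≥ j≮n) = z≤n , z≤n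

GT-steps : ∀ (C : Chain n) → GT C →
           Steps (λ f h → ∀ j → h (suc j) ≤ f j × f j ≤ h j) zeros (undowns C)
GT-steps {zero}  C       _          = tt
GT-steps {suc n} (μ , C) (int , gt) =
  subst (λ f → ∀ j → undown μ (suc j) ≤ f j × f j ≤ undown μ j) (sym (peak-undowns C)) (interlacing-undown μ (top C) int) ,
  GT-steps C gt

ladder-stack : ∀ (C : Chain n) {H} → (∀ {i} → i ≤ n → ∀ j → H i j ≡ stack zeros (undowns C) i j) → ladder n H ≡ C
ladder-stack {zero}  C       eq = refl
ladder-stack {suc n} (μ , C) eq = cong₂ _,_
  (trans (down-cong (suc n) (λ {j} _ → trans (eq ≤-refl j) (cong (λ f → f j) (stack-peak zeros (undown μ ∷ undowns C)))))
    (down-undown μ))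
  (ladder-stack C (λ i≤n j → trans (eq (m≤n⇒m≤1+n i≤n) j) (cong (λ f → f j) (stack-below zeros (undown μ) (undowns C) i≤n))))

module SSYT {μ : List ℕ} (isPartition : IsPartition μ) where

  record Bounded (n : ℕ) (t : Filling) : Set where
    constructor bounded-ssyt
    field
      isSSYT : IsSSYT μ t
      ≤n     : All (_≤ n) (letters t)

    frame : Framed (part []) (part μ) n t
    frame = framed {μ} {[]} (λ _ → z≤n) (proj₁ isSSYT) (proj₁ (proj₂ isSSYT)) ≤n

    κ : ℕ → ℕ → ℕ
    κ = level (part []) t

    κ-diagonal : ∀ i j → κ (suc i) (suc j) ≤ κ i j
    κ-diagonal i = upColumns⇒level frame (λ _ → z≤n) (part-antitone (proj₁ isPartition))
      (proj₂ (proj₂ isSSYT)) (λ v<w w≤1+i → s≤s⁻¹ (≤-trans v<w w≤1+i))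

    -- Columns increase strictly, so the letters in row `j`, counted from 0, are at least `j + 1`.
    κ-beyond : ∀ {i j} → i ≤ j → κ i j ≡ 0
    κ-beyond {zero}  {j}     _         = level-zero frame j
    κ-beyond {suc i} {suc j} (s≤s i≤j) = n≤0⇒n≡0 (≤-trans (κ-diagonal i j) (≤-reflexive (κ-beyond i≤j)))

    GT-ladder : ∀ m → GT (ladder m κ)
    GT-ladder zero    = tt
    GT-ladder (suc m) =
      subst (Interlacing (down (suc m) (κ (suc m)))) (sym (top-ladder m κ))
        (from (interlacing⇔ m (κ (suc m)) (κ m)) (λ {j} _ → κ-diagonal m j , level-mono frame j (n≤1+n m))) ,
      GT-ladder m

    top-κ : top (ladder n κ) ≡ down n (part μ)
    top-κ = trans (top-ladder n κ) (down-cong n (λ {j} _ → level-top frame j))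

    -- With more than `n` parts, row `n` would be nonempty, as parts are positive, and would be
    -- filled with letters at most `n`, against `κ-beyond`.
    length-μ : length μ ≤ n
    length-μ with length μ ≤? n
    ... | yes ≤n = ≤n
    ... | no ≰n  = contradiction (trans (sym (level-top frame n)) (κ-beyond ≤-refl))
      (λ eq → <-irrefl (sym eq) (part-positive (proj₂ isPartition) (≰⇒> ≰n)))

    content-ladder : ∀ m → Content (λ i → count (suc i) (letters t)) (ladder m κ)
    content-ladder zero    = tt
    content-ladder (suc m) = (begin
      Vec.sum (down (suc m) (κ (suc m)))
        ≡⟨ cong Vec.sum (down-cong (suc m) (λ {j} _ → count≤-suc (at t j) m)) ⟩
      Vec.sum (down (suc m) (λ j → κ m j + c j))
        ≡⟨ sum-down-+ (suc m) (κ m) c ⟩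
      Vec.sum (down (suc m) (κ m)) + Vec.sum (down (suc m) c)
        -- The extra entry of the longer vector is `κ m m`, which is 0 since row `m` has no letter
        -- at most `m`.
        ≡⟨ cong₂ _+_ (cong (_+ Vec.sum (down m (κ m))) (κ-beyond {m} ≤-refl)) total ⟩
      Vec.sum (down m (κ m)) + count (suc m) (letters t)
        ≡⟨ +-comm _ (count (suc m) (letters t)) ⟩
      count (suc m) (letters t) + Vec.sum (down m (κ m))
        ≡⟨ cong (λ v → count (suc m) (letters t) + Vec.sum v) (sym (top-ladder m κ)) ⟩
      count (suc m) (letters t) + Vec.sum (top (ladder m κ)) ∎) , content-ladder m
      where
      open ≡-Reasoning
      c : ℕ → ℕ
      c j = count (suc m) (map letter (at t j))
      c-beyond : ∀ {j} → suc m ≤ j → c j ≡ 0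
      c-beyond {j} m<j = n≤0⇒n≡0 (≤-trans (m≤n+m (c j) (count≤ m (at t j)))
        (≤-reflexive (trans (sym (count≤-suc (at t j) m)) (κ-beyond m<j))))
      count-letters : ∀ t → count (suc m) (letters t) ≡ Vec.sum (tab (length t) (λ j → count (suc m) (map letter (at t j))))
      count-letters []        = refl
      count-letters (row ∷ t) = trans (cong (count (suc m)) (map-++ letter row (concat t)))
        (trans (count-++ (suc m) (map letter row) (letters t)) (cong (count (suc m) (map letter row) +_) (count-letters t)))
      total : Vec.sum (down (suc m) c) ≡ count (suc m) (letters t)
      total = trans (sum-down-supported c c-beyond (λ l≤j → cong (count (suc m) ∘ map letter) (at-beyond t l≤j)))
        (sym (trans (count-letters t) (sum-down-tab (length t) c)))

  open Bounded

  ladder-determined : ∀ {n t t′} → Bounded n t → Bounded n t′ →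
    ladder n (level (part []) t) ≡ ladder n (level (part []) t′) → t ≡ t′
  ladder-determined {n} {t} {t′} B B′ eq = level-determined (frame B) (frame B′)
    (trans (filling-length {μ} {[]} (proj₁ (isSSYT B))) (sym (filling-length {μ} {[]} (proj₁ (isSSYT B′))))) levels≡
    where
    levels≡ : ∀ i j → i ≤ n → κ B i j ≡ κ B′ i j
    levels≡ i j i≤n with j <? i
    ... | yes j<i = down-injective i (ladder-injective n i≤n eq) j<i
    ... | no j≮i  = trans (κ-beyond B (≮⇒≥ j≮i)) (sym (κ-beyond B′ (≮⇒≥ j≮i)))

  fromChain : ∀ {n} → length μ ≤ n → (C : Chain n) → GT C → top C ≡ down n (part μ) →
              ∃ λ t → Bounded n t × ladder n (level (part []) t) ≡ C
  fromChain {n} l≤n C gt top≡ = t , bounded-ssyt (proj₁ isFilling×rows , proj₂ isFilling×rows , up) (letters-bounded F) ,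
    ladder-stack C κ≡G
    where
    G = stack zeros (undowns C)
    step : ∀ {i} → i < n → ∀ j → G (suc i) (suc j) ≤ G i j × G i j ≤ G (suc i) j
    step = stack-step _ zeros (undowns C) (GT-steps C gt)
    mono : ∀ j → Monotone n (λ i → G i j)
    mono j = steps⇒monotone n (λ i<n → proj₂ (step i<n j))
    G0 : ∀ j → G 0 j ≡ 0
    G0 j = cong (λ f → f j) (stack-base zeros (undowns C))
    Gn : ∀ j → G n j ≡ part μ j
    Gn j = trans (cong (λ f → f j) (trans (stack-peak zeros (undowns C)) (peak-undowns C))) (undown-top j)
      where
      undown-top : ∀ j → undown (top C) j ≡ part μ j
      undown-top j with j <? n
      ... | yes j<n = down-injective n (trans (down-undown (top C)) top≡) j<n
      ... | no j≮n  = trans (undown-beyond (top C) (≮⇒≥ j≮n)) (sym (part-beyond μ (≤-trans l≤n (≮⇒≥ j≮n))))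
    empty : ∀ {j} → length μ ≤ j → G n j ≡ 0
    empty {j} l≤j = trans (Gn j) (part-beyond μ l≤j)
    t = fill (length μ) n G
    F : Framed (part []) (part μ) n t
    F = framed-≡ G0 Gn (fill-framed mono empty)
    κ≡G : ∀ {i} → i ≤ n → ∀ j → level (part []) t i j ≡ G i j
    κ≡G {i} i≤n j = trans (cong (_+ count≤ i (at t j)) (sym (G0 j))) (level-fill mono empty j i≤n)
    G-desc : ∀ {i} → i ≤ n → ∀ j → G i (suc j) ≤ G i j
    G-desc {zero}  _   j = ≤-reflexive (trans (G0 (suc j)) (sym (G0 j)))
    G-desc {suc i} i<n j = ≤-trans (proj₁ (step i<n j)) (proj₂ (step i<n j))
    diagonal : ∀ {j j′} w → w ≤ n → j < j′ → G w j′ ≤ G (pred w) j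
    diagonal {j} {j′}     zero    _   _         = ≤-trans (≤-reflexive (G0 j′)) z≤n
    diagonal {j} {suc j′} (suc w) w<n (s≤s j≤j′) =
      ≤-trans (proj₁ (step w<n j′)) (antitone {G w} (G-desc (<⇒≤ w<n)) j≤j′)
    up : UpColumns _<_ t
    up = level⇒upColumns F pred (λ { {w = suc w} _ v≤w → s≤s v≤w }) λ {j} {j′} w w≤n j<j′ →
      subst₂ _≤_ (sym (κ≡G w≤n j′)) (sym (κ≡G (≤-trans pred[n]≤n w≤n) j)) (diagonal w w≤n j<j′)
    isFilling×rows = isFilling⁺ {μ} {[]} F (length-applyUpTo _ (length μ))

-- The bijection

module _ {A B : Set} (F : A → List B) where

  pairs : List A → List (A × B)
  pairs []       = []
  pairs (x ∷ xs) = map (x ,_) (F x) ++ pairs xs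

  length-pairs : ∀ xs → length (pairs xs) ≡ List.sum (map (length ∘ F) xs)
  length-pairs []       = refl
  length-pairs (x ∷ xs) = trans (length-++ (map (x ,_) (F x)))
    (cong₂ _+_ (length-map (x ,_) (F x)) (length-pairs xs))

  ∈-pairs⁺ : ∀ {xs x y} → x ∈ xs → y ∈ F x → (x , y) ∈ pairs xs
  ∈-pairs⁺ {x ∷ xs} (here refl) y∈ = ∈-++⁺ˡ (∈-map⁺ (x ,_) y∈)
  ∈-pairs⁺ {x ∷ xs} (there x∈)  y∈ = ∈-++⁺ʳ (map (x ,_) (F x)) (∈-pairs⁺ x∈ y∈)

  ∈-pairs⁻ : ∀ {xs x y} → (x , y) ∈ pairs xs → x ∈ xs × y ∈ F x
  ∈-pairs⁻ {x′ ∷ xs} p with ∈-++⁻ (map (x′ ,_) (F x′)) p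
  ... | inj₁ q with y , y∈ , refl ← ∈-map⁻ (x′ ,_) q = here refl , y∈
  ... | inj₂ q with x∈ , y∈ ← ∈-pairs⁻ q = there x∈ , y∈

  pairs-unique : ∀ {xs} → Unique xs → (∀ x → Unique (F x)) → Unique (pairs xs)
  pairs-unique []       _  = []
  pairs-unique {x ∷ xs} (u ∷ us) us′ = Unique.++⁺ (Unique.map⁺ (cong proj₂) (us′ x)) (pairs-unique us us′) disjoint
    where
    disjoint : ∀ {p} → ¬ (p ∈ map (x ,_) (F x) × p ∈ pairs xs)
    disjoint (p , q) with _ , _ , refl ← ∈-map⁻ (x ,_) p = All.lookup u (proj₁ (∈-pairs⁻ q)) refl

-- Both sides of the identity are mapped injectively into this type. The bijection then becomes an
-- equality of two sets of codes, and equal sets without repetition have equal length.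
Code : ℕ → ℕ → Set
Code n l = Mat n l × Chain n

module _ {l ν λ′} (S : Skew l ν λ′) (α : List ℕ) where
  open Skew S
  open RPP S

  private
    k = length α
    start = tab l (part λ′)
    rs = elements (rpps ν λ′ α)
    Ts = elements (yamanouchiTabloids ν λ′)
    tableaux : Tabloid → List Filling
    tableaux T = elements (ssyts (weight (readingWord T)) α)

    matrix : Tabloid → Mat k l
    matrix T = mat k l (multiplicity T)

    rppCode : Filling → Code k l
    rppCode r = rsk (matrix (tabloid r)) , shapes (matrix (tabloid r))

    pairCode : Tabloid × Filling → Code k l
    pairCode (T , t) = matrix T , ladder k (level (part []) t)

    columnCount letterCount : Filling → ℕ → ℕ
    columnCount r i = length (columnsContaining (suc i) r)
    letterCount t i = count (suc i) (letters t)

    column-support : ∀ r i → 0 < columnCount r i ⇔ suc i ∈ letters r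
    column-support r i = columnsContaining-support r (suc i)

    letter-support : ∀ t i → 0 < letterCount t i ⇔ suc i ∈ letters t
    letter-support t i = count-support (letters t) (suc i)

    content-rpp : ∀ {r} → Bounded k r → Content (columnCount r) (shapes (matrix (tabloid r)))
    content-rpp {r} B = content-cong k (λ i → sym (Bounded.sum-multiplicity B (suc i))) _
      (content-shapes k l (multiplicity (tabloid r)))
      where
      content-cong : ∀ m {a b} → (∀ i → a i ≡ b i) → (C : Chain m) → Content a C → Content b C
      content-cong zero    eq C       _        = tt
      content-cong (suc m) eq (μ , C) (p , ps) = trans p (cong (_+ Vec.sum (top C)) (eq m)) , content-cong m eq C ps

    record YamTabloid (T : Tabloid) : Set where
      field
        source  : Filling
        rpp     : Bounded k source
        eq      : tabloid source ≡ T
        yam     : IsYamanouchi T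
        word≤n  : All (_≤ k) (readingWord T)

      length≡ : length T ≡ l
      length≡ = trans (cong length (sym eq)) (trans (length-tabloid source) (Bounded.length≡ rpp))

      isTabloid : IsTabloid T
      isTabloid = subst IsTabloid eq (Bounded.isTabloid rpp)

      partitionWeight : IsPartition (weight (readingWord T))
      partitionWeight = All.head yam

      yam-matrix : Yam (matrix T)
      yam-matrix = subst (λ l → Yam (mat k l (multiplicity T))) length≡
        (to (yamanouchi⇔yam T (proj₂ isTabloid) word≤n) yam)

      weights-matrix : weights (matrix T) ≡ down k (part (weight (readingWord T)))
      weights-matrix = subst (λ l → weights (mat k l (multiplicity T)) ≡ down k (part (weight (readingWord T)))) length≡
        (weights-mat k T)

      act-matrix : act (matrix T) start ≡ tab l (part ν)
      act-matrix = subst (λ T → act (matrix T) start ≡ tab l (part ν)) eq (Bounded.act-mat-top rpp)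

    word-bounded : ∀ {r} → Bounded k r → All (_≤ k) (readingWord (tabloid r))
    word-bounded {r} B = All.concat⁺ (All.tabulate λ row∈ → All.lookup rows≤n (reverse⁻ row∈))
      where
      rows≤n : All (All (_≤ k)) (tabloid r)
      rows≤n = all-at (tabloid r) λ j →
        subst (All (_≤ k)) (sym (at-tabloid r j)) (All.map⁺ (All.filter⁺ _ (Framed.bounded (Bounded.frame B) j)))

    yam-tabloid : ∀ {r} → Bounded k r → Yam (matrix (tabloid r)) → YamTabloid (tabloid r)
    yam-tabloid {r} B yam = record
      { source = r ; rpp = B ; eq = refl ; word≤n = word-bounded B
      ; yam = from (yamanouchi⇔yam (tabloid r) (proj₂ (Bounded.isTabloid B)) (word-bounded B))
          (subst (λ l → Yam (mat k l (multiplicity (tabloid r)))) (sym (trans (length-tabloid r) (Bounded.length≡ B))) yam)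
      }

    rs⁻ : ∀ {r} → r ∈ rs → Bounded k r × rppWeight r ≡ α
    rs⁻ {r} r∈ with isRPP , w≡ ← to (complete (rpps ν λ′ α) r) r∈ =
      bounded-rpp isRPP (proj₁ (exponents⁻ (columnCount r) (letters r) (column-support r) w≡)) , w≡

    pairs⁻ : ∀ {T t} → (T , t) ∈ pairs tableaux Ts →
             Σ (YamTabloid T) λ Y → SSYT.Bounded (YamTabloid.partitionWeight Y) k t × weight (letters t) ≡ α
    pairs⁻ {T} {t} p with T∈ , t∈ ← ∈-pairs⁻ tableaux {Ts} p
      with isT , yam , r , isRPP , refl ← to (complete (yamanouchiTabloids ν λ′) T) T∈
      with isSSYT , w≡ ← to (complete (ssyts (weight (readingWord T)) α) t) t∈ =
      record
        { source = r ; eq = refl ; yam = yam ; word≤n = word≤n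
        ; rpp = bounded-rpp isRPP (All.map⁺ (All.tabulate λ c∈ →
            All.lookup word≤n (concat⊆readingWord (tabloid r) (letter-survives r c∈))))
        } ,
      tBounded , w≡
      where
      tBounded : SSYT.Bounded (All.head yam) k t
      tBounded = SSYT.bounded-ssyt isSSYT (proj₁ (exponents⁻ (letterCount t) (letters t) (letter-support t) w≡))
      -- The number of parts of the weight is the largest letter of the tabloid, and `t` has this
      -- weight as its shape and letters at most `k`, so `length-μ` bounds it.
      word≤n : All (_≤ k) (readingWord (tabloid r))
      word≤n = All.map (λ x≤ → ≤-trans x≤ (≤-trans (≤-reflexive (sym (length-applyUpTo _ (largest (readingWord (tabloid r))))))
        (SSYT.Bounded.length-μ tBounded))) (≤-largest (readingWord (tabloid r)))

    pairs⁺ : ∀ {T t} (Y : YamTabloid T) → SSYT.Bounded (YamTabloid.partitionWeight Y) k t →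
             weight (letters t) ≡ α → (T , t) ∈ pairs tableaux Ts
    pairs⁺ {T} {t} Y B w≡ = ∈-pairs⁺ tableaux
      (from (complete (yamanouchiTabloids ν λ′) T) (isTabloid , yam , source , Bounded.isRPP rpp , eq))
      (from (complete (ssyts (weight (readingWord T)) α) t) (SSYT.Bounded.isSSYT B , w≡))
      where open YamTabloid Y

    -- The common pattern determines its content, which is given by the column counts of `r` and by
    -- the letter counts of `t`.
    counts-agree : ∀ {r T t} (B : Bounded k r) (Y : YamTabloid T) (D : SSYT.Bounded (YamTabloid.partitionWeight Y) k t) →
      shapes (matrix (tabloid r)) ≡ ladder k (level (part []) t) → ∀ {i} → i < k → columnCount r i ≡ letterCount t i
    counts-agree {r} {T} {t} B Y D eq =
      content-unique (ladder k (level (part []) t)) (subst (Content (columnCount r)) eq (content-rpp B))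
        (SSYT.Bounded.content-ladder D k)

    insertion : ∀ {r} → Bounded k r → rppWeight r ≡ α →
      ∃₂ λ T t → Σ (YamTabloid T) λ Y → SSYT.Bounded (YamTabloid.partitionWeight Y) k t ×
        weight (letters t) ≡ α × rppCode r ≡ pairCode (T , t)
    insertion {r} B w≡ = tabloid r′ , t , Y , D , weight≡ , cong₂ _,_ (sym mat≡) (sym ladder≡)
      where
      A = matrix (tabloid r)
      inflated = inflate (rsk A) (trans (act-rsk A start) (Bounded.act-mat-top B))
      r′ = proj₁ inflated
      mat≡ : matrix (tabloid r′) ≡ rsk A
      mat≡ = proj₂ (proj₂ inflated)
      Y : YamTabloid (tabloid r′)
      Y = yam-tabloid (proj₁ (proj₂ inflated)) (subst Yam (sym mat≡) (Yam-rsk A))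
      length≤n : length (weight (readingWord (tabloid r′))) ≤ k
      length≤n = ≤-trans (≤-reflexive (length-applyUpTo _ (largest (readingWord (tabloid r′)))))
        (largest-≤ (readingWord (tabloid r′)) (YamTabloid.word≤n Y))
      tableau = SSYT.fromChain (YamTabloid.partitionWeight Y) {k} length≤n (shapes A) (GT-shapes A)
        (trans (top-shapes A) (trans (cong weights (sym mat≡)) (YamTabloid.weights-matrix Y)))
      t = proj₁ tableau
      D : SSYT.Bounded (YamTabloid.partitionWeight Y) k t
      D = proj₁ (proj₂ tableau)
      ladder≡ : ladder k (level (part []) t) ≡ shapes A
      ladder≡ = proj₂ (proj₂ tableau)
      weight≡ : weight (letters t) ≡ α
      weight≡ with _ , ntz , values ← exponents⁻ (columnCount r) (letters r) (column-support r) w≡ =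
        exponents⁺ (letterCount t) (letters t) (letter-support t) (SSYT.Bounded.≤n D) ntz
          (λ i<n → trans (sym (counts-agree B Y D (sym ladder≡) i<n)) (values i<n))

    removal : ∀ {T t} (Y : YamTabloid T) → SSYT.Bounded (YamTabloid.partitionWeight Y) k t →
      weight (letters t) ≡ α → ∃ λ r → Bounded k r × rppWeight r ≡ α × pairCode (T , t) ≡ rppCode r
    removal {T} {t} Y D w≡ = r , B , weight≡ , cong₂ _,_ (trans (sym rsk≡) (cong rsk (sym mat≡))) (sym shapes≡)
      where
      preimage = rsk-surjective (matrix T) (ladder k (level (part []) t)) (YamTabloid.yam-matrix Y)
        (SSYT.Bounded.GT-ladder D k) (trans (SSYT.Bounded.top-κ D) (sym (YamTabloid.weights-matrix Y)))
      A = proj₁ preimage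
      rsk≡ : rsk A ≡ matrix T
      rsk≡ = proj₁ (proj₂ preimage)
      inflated = inflate A (trans (sym (act-rsk A start))
        (trans (cong (λ A → act A start) rsk≡) (YamTabloid.act-matrix Y)))
      r = proj₁ inflated
      B : Bounded k r
      B = proj₁ (proj₂ inflated)
      mat≡ : matrix (tabloid r) ≡ A
      mat≡ = proj₂ (proj₂ inflated)
      shapes≡ : shapes (matrix (tabloid r)) ≡ ladder k (level (part []) t)
      shapes≡ = trans (cong shapes mat≡) (proj₂ (proj₂ preimage))
      weight≡ : rppWeight r ≡ α
      weight≡ with _ , ntz , values ← exponents⁻ (letterCount t) (letters t) (letter-support t) w≡ =
        exponents⁺ (columnCount r) (letters r) (column-support r) (Bounded.≤n B) ntz
          (λ i<n → trans (counts-agree B Y D shapes≡ i<n) (values i<n))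

    forward : ∀ {r} → r ∈ rs → ∃ λ p → p ∈ pairs tableaux Ts × rppCode r ≡ pairCode p
    forward r∈ =
      let B , w≡ = rs⁻ r∈
          T , t , Y , D , w≡′ , eq = insertion B w≡
      in (T , t) , pairs⁺ Y D w≡′ , eq

    backward : ∀ {p} → p ∈ pairs tableaux Ts → ∃ λ r → r ∈ rs × pairCode p ≡ rppCode r
    backward p∈ =
      let Y , D , w≡ = pairs⁻ p∈
          r , B , w≡′ , eq = removal Y D w≡
      in r , from (complete (rpps ν λ′ α) r) (Bounded.isRPP B , w≡′) , eq

    rppCode-injective : ∀ {r r′} → r ∈ rs → r′ ∈ rs → rppCode r ≡ rppCode r′ → r ≡ r′
    rppCode-injective r∈ r′∈ eq = mat-tabloid-injective (proj₁ (rs⁻ r∈)) (proj₁ (rs⁻ r′∈))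
      (rsk-injective _ _ (cong proj₁ eq) (cong proj₂ eq))

    tabloid-determined : ∀ {T T′} → YamTabloid T → YamTabloid T′ → matrix T ≡ matrix T′ → T ≡ T′
    tabloid-determined Y Y′ eq = trans (sym (YamTabloid.eq Y)) (trans (cong tabloid
      (mat-tabloid-injective (YamTabloid.rpp Y) (YamTabloid.rpp Y′)
        (trans (cong matrix (YamTabloid.eq Y)) (trans eq (cong matrix (sym (YamTabloid.eq Y′)))))))
      (YamTabloid.eq Y′))

    tableau-determined : ∀ {T T′ t t′} → T ≡ T′ → (Y : YamTabloid T) (Y′ : YamTabloid T′) →
      SSYT.Bounded (YamTabloid.partitionWeight Y) k t → SSYT.Bounded (YamTabloid.partitionWeight Y′) k t′ →
      ladder k (level (part []) t) ≡ ladder k (level (part []) t′) → (T , t) ≡ (T′ , t′)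
    -- `SSYT.Bounded` depends on the proof that the shape is a partition, so the second record is
    -- taken apart and rebuilt over the proof from `Y`.
    tableau-determined refl Y Y′ D (SSYT.bounded-ssyt isSSYT ≤n) eq =
      cong (_ ,_) (SSYT.ladder-determined (YamTabloid.partitionWeight Y) D (SSYT.bounded-ssyt isSSYT ≤n) eq)

    pairCode-injective : ∀ {p q} → p ∈ pairs tableaux Ts → q ∈ pairs tableaux Ts → pairCode p ≡ pairCode q → p ≡ q
    pairCode-injective p∈ q∈ eq =
      let Y , D , _ = pairs⁻ p∈
          Y′ , D′ , _ = pairs⁻ q∈
      in tableau-determined (tabloid-determined Y Y′ (cong proj₁ eq)) Y Y′ D D′ (cong proj₂ eq)

  rpps-pairs : ∣ rpps ν λ′ α ∣ ≡ List.sum (map (λ T → s (weight (readingWord T)) α) Ts)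
  rpps-pairs = begin
    length rs                              ≡⟨ length-map rppCode rs ⟨
    length (map rppCode rs)                ≡⟨ unique-length
      (map-unique rppCode (unique (rpps ν λ′ α)) rppCode-injective)
      (map-unique pairCode (pairs-unique tableaux (unique (yamanouchiTabloids ν λ′))
        (λ T → unique (ssyts (weight (readingWord T)) α))) pairCode-injective)
      (λ _ → mk⇔ forth back) ⟩
    length (map pairCode (pairs tableaux Ts)) ≡⟨ length-map pairCode (pairs tableaux Ts) ⟩
    length (pairs tableaux Ts)             ≡⟨ length-pairs tableaux Ts ⟩
    List.sum (map (length ∘ tableaux) Ts)  ∎
    where
    open ≡-Reasoning
    forth : ∀ {c} → c ∈ map rppCode rs → c ∈ map pairCode (pairs tableaux Ts)
    forth c∈ =
      let r , r∈ , c≡ = ∈-map⁻ rppCode c∈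
          p , p∈ , eq = forward r∈
      in subst (_∈ map pairCode (pairs tableaux Ts)) (sym (trans c≡ eq)) (∈-map⁺ pairCode p∈)
    back : ∀ {c} → c ∈ map pairCode (pairs tableaux Ts) → c ∈ map rppCode rs
    back c∈ =
      let p , p∈ , c≡ = ∈-map⁻ pairCode c∈
          r , r∈ , eq = backward p∈
      in subst (_∈ map rppCode rs) (sym (trans c≡ eq)) (∈-map⁺ rppCode r∈)

proposition46 : (ν λ′ : List ℕ) → IsPartition ν → IsPartition λ′ → λ′ ⊆ ν →
    g ν λ′ ≈ ∑ (map (λ T → s (weight (readingWord T))) (elements (yamanouchiTabloids ν λ′)))
proposition46 ν λ′ pν pλ λ⊆ν α = trans
  (rpps-pairs {ν = ν} {λ′} record
    { rows = refl ; inside = λ⊆ν ; ν-desc = part-antitone (proj₁ pν) ; λ-desc = part-antitone (proj₁ pλ) } α)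
  (cong List.sum (map-∘ (elements (yamanouchiTabloids ν λ′))))
  where import Data.List.Properties
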